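{- Let $f_1,f_2$ be functions given by Dirichlet series $f_i(s)=\sum_{n\ge1}a_i(n)n^{ -s}$ convergent in some half planes, and let $\sum_{n\ge1}b_i(n)n^{ -s}$ ($i=1,2$) be Dirichlet series convergent in some half planes. Let $\psi_1(s),\psi_2(s)$ be given functions and let $\delta$ be a fixed complex number. Suppose that in a certain region of the complex plane $f_1$ and $f_2$ satisfy the relations $$f_1(s)=\sum_{n\le x_1}a_1(n)n^{ -s}+\psi_1(s)\sum_{n\le y_1}b_1(n)n^{s-\delta}+E_1(s,x_1),$$ $$f_2(s)=\sum_{n\le x_2}a_2(n)n^{ -s}+\psi_2(s)\sum_{n\le y_2}b_2(n)n^{s-\delta}+E_2(s,x_2),$$ with $x_1,x_2>0$, $y_1=T_1/x_1$, $y_2=T_2/x_2$, so that $y_1,y_2\ge0$. Then in the same region $$f_1(s)f_2(s)=\sum_{n\le x_1x_2}A(n)n^{ -s}+\psi_1(s)\psi_2(s)\sum_{n\le y_1y_2}B(n)n^{s-\delta}+E_{1,2}(s,x_1x_2),$$ where $A(n)=\sum_{uv=n}a_1(u)a_2(v)$, $B(n)=\sum_{uv=n}b_1(u)b_2(v)$ and $$E_{1,2}(s,x_1x_2)=I_1+I_2+I_3+I_4+I_5+L_1+L_2$$ with $$I_1=\sum_{n\le x_1}a_1(n)n^{ -s}E_2\Big(s,\frac{x_1x_2}{n}\Big),\qquad I_2=\sum_{n\le x_2}a_2(n)n^{ -s}E_1\Big(s,\frac{x_1x_2}{n}\Big),$$ $$I_3=\psi_1(s)\sum_{m\le y_1}b_1(m)m^{s-\delta}E_2\Big(s,\frac{mx_2}{y_1}\Big),\qquad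 I_4=\psi_2(s)\sum_{m\le y_2}b_2(m)m^{s-\delta}E_1\Big(s,\frac{mx_1}{y_2}\Big),$$ $$I_5=E_1(s,x_1)E_2(s,x_2),$$ $$L_1=\psi_1(s)\,\ell_2^{ -s}\sum_{m\le y_1}b_1(m)\,a_2(\ell_2m)\,m^{ -\delta},\qquad L_2=\psi_2(s)\,\ell_1^{ -s}\sum_{n\le y_2}b_2(n)\,a_1(\ell_1n)\,n^{ -\delta},$$ where $\ell_1=x_1/y_2$, $\ell_2=x_2/y_1$, and $a_1(\ell_1n)=0$ if $\ell_1n$ is not an integer, $a_2(\ell_2m)=0$ if $\ell_2m$ is not an integer. In addition, if there are functional equations $f_1(s)=\psi_1(s)f_1(\delta-s)$ and $f_2(s)=\psi_2(s)f_2(\delta-s)$, then $$I_3=\psi_1(s)\psi_2(s)\sum_{n\le y_1}b_1(n)n^{s-\delta}E_2\Big(\delta-s,\frac{y_1y_2}{n}\Big),\qquad I_4=\psi_1(s)\psi_2(s)\sum_{n\le y_2}b_2(n)n^{s-\delta}E_1\Big(\delta-s,\frac{y_1y_2}{n}\Big).$$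
   Context: All sums run over positive integers. The displayed relation for $f_i$, taken for every real $x_i>0$, defines the remainder $E_i(s,x)$; $E_i(\delta-s,x)$ is the remainder in the same relation at the point $\delta-s$. The quantities $T_1,T_2\ge0$ depend only on $s$ (and possibly some other parameters), $T_1$ being independent of $x_1$ and $T_2$ independent of $x_2$. Empty sums are zero; in particular if $y_1<1$ or $y_2<1$ (including the value $0$), the corresponding sums over $n\le y_1$ or $n\le y_2$ are zero. $E_{1,2}(s,x_1x_2)$ is the name of the remainder term for the given $x_1,x_2$.
   Formalization: The last part (formulas for I_3, I_4) is false as stated; it is proved assuming also b_i=a_i, T_i(δ-s)=T_i(s), ψ_i(s)ψ_i(δ-s)=1 where f_i(s)=0, both s and δ-s in the region, and y_1y_2>0 if the sum is non-empty. -}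

module Defs where

open import Algebra.Structures using (IsCommutativeRing)
open import Data.List.Base using (List; map; foldr; filter; head; applyUpTo; cartesianProduct)
open import Data.Maybe.Base using (maybe′)
import Data.Nat.Base as ℕ
open ℕ using (ℕ; suc)
import Data.Nat.Properties as ℕₚ
open import Data.Nat.GeneralisedArithmetic using (fold)
open import Data.Product.Base using (∃; ∃-syntax; _×_; _,_; proj₁)
open import Level using (0ℓ) renaming (suc to lsuc)
open import Relation.Binary.Core using (Rel)
open import Relation.Binary.PropositionalEquality using (_≡_; _≢_)
open import Relation.Binary.Structures using (IsDecTotalOrder)
open import Relation.Unary using (Pred)

-- The real numbers, as a Dedekind-complete ordered field; classically such a
-- field is unique up to a unique isomorphism.  The order is decidable, as it
-- is classically, so that the range of summation n ≤ x makes sense.  The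
-- inverse is total and 0 ⁻¹ is unspecified.
record CompleteOrderedField : Set (lsuc 0ℓ) where
  infix  4 _≤_ _<_
  infixl 6 _+_ _-_
  infixl 7 _*_ _/_
  infix  8 -_
  infix  9 _⁻¹
  field
    ℝ                 : Set
    _+_ _*_           : ℝ → ℝ → ℝ
    -_ _⁻¹            : ℝ → ℝ
    0# 1#             : ℝ
    _≤_               : Rel ℝ 0ℓ
    isCommutativeRing : IsCommutativeRing _≡_ _+_ _*_ -_ 0# 1#
    0≢1               : 0# ≢ 1#
    ⁻¹-inverseʳ       : ∀ x → x ≢ 0# → x * x ⁻¹ ≡ 1#
    isDecTotalOrder   : IsDecTotalOrder _≡_ _≤_
    +-monoʳ-≤         : ∀ x {y z} → y ≤ z → x + y ≤ x + z
    *-nonNegative     : ∀ {x y} → 0# ≤ x → 0# ≤ y → 0# ≤ x * y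

  _<_ : Rel ℝ 0ℓ
  x < y = x ≤ y × x ≢ y

  fromℕ : ℕ → ℝ
  fromℕ = fold 0# (1# +_)

  UpperBound : Pred ℝ 0ℓ → Pred ℝ 0ℓ
  UpperBound P u = ∀ x → P x → x ≤ u

  field
    -- Classically a consequence of completeness; constructively it is what
    -- provides an actual integer bound.
    archimedean : ∀ x → ∃[ n ] x ≤ fromℕ n
    complete    : ∀ (P : Pred ℝ 0ℓ) → ∃ P → ∃ (UpperBound P) →
                  ∃[ u ] UpperBound P u × (∀ v → UpperBound P v → u ≤ v)

  _-_ _/_ : ℝ → ℝ → ℝ
  x - y = x + - y
  x / y = x * y ⁻¹

  open IsDecTotalOrder isDecTotalOrder public using (_≤?_; _≟_)

  -- The list 1, …, N for some integer N with x ≤ N.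
  positivesTo : ℝ → List ℕ
  positivesTo x = applyUpTo suc (proj₁ (archimedean x))

module Complex (R : CompleteOrderedField) where
  open CompleteOrderedField R public
    using (ℝ; 0#; 1#; fromℕ; positivesTo)
    renaming ( _+_ to _+ᴿ_; _-_ to _-ᴿ_; _*_ to _*ᴿ_; -_ to -ᴿ_; _/_ to _/ᴿ_
             ; _≤_ to _≤ᴿ_; _<_ to _<ᴿ_; _≤?_ to _≤ᴿ?_; _≟_ to _≟ᴿ_ )

  infix  5 _+i_
  infixl 6 _+_ _-_
  infixl 7 _*_
  infix  8 -_

  record ℂ : Set where
    constructor _+i_
    field
      re im : ℝ
  open ℂ public

  ofℝ : ℝ → ℂ
  ofℝ x = x +i 0#

  0ℂ 1ℂ : ℂ
  0ℂ = ofℝ 0#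
  1ℂ = ofℝ 1#

  -_ : ℂ → ℂ
  - z = (-ᴿ re z) +i (-ᴿ im z)

  _+_ _-_ _*_ : ℂ → ℂ → ℂ
  z + w = (re z +ᴿ re w) +i (im z +ᴿ im w)
  z - w = z + - w
  z * w = (re z *ᴿ re w -ᴿ im z *ᴿ im w) +i (re z *ᴿ im w +ᴿ im z *ᴿ re w)

  ∣_∣² : ℂ → ℝ
  ∣ z ∣² = re z *ᴿ re z +ᴿ im z *ᴿ im z

  sum : List ℂ → ℂ
  sum = foldr _+_ 0ℂ

  -- Squared moduli are compared with positive reals throughout, which
  -- quantifies over the same conditions as comparing moduli.
  _⟶_ : (ℕ → ℂ) → ℂ → Set
  u ⟶ l = ∀ ε → 0# <ᴿ ε → ∃[ N ] (∀ M → N ℕ.≤ M → ∣ u M - l ∣² <ᴿ ε)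

  -- The complex exponential is the unique homomorphism from (ℂ, +) to (ℂ, *)
  -- with derivative 1 at 0.  The values of log outside the positive reals are
  -- unspecified.
  record Exponential : Set where
    field
      exp     : ℂ → ℂ
      exp-+   : ∀ z w → exp (z + w) ≡ exp z * exp w
      exp′-0  : ∀ ε → 0# <ᴿ ε → ∃[ η ] 0# <ᴿ η ×
                (∀ z → ∣ z ∣² <ᴿ η → ∣ (exp z - 1ℂ) - z ∣² ≤ᴿ ε *ᴿ ∣ z ∣²)
      log     : ℝ → ℝ
      exp-log : ∀ x → 0# <ᴿ x → exp (ofℝ (log x)) ≡ ofℝ x
      log-exp : ∀ x r → exp (ofℝ r) ≡ ofℝ x → log x ≡ r

module Dirichlet (R : CompleteOrderedField) (X : Complex.Exponential R) where
  open Complex R public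
  open Exponential X public

  infixr 9 _^_

  _^_ : ℝ → ℂ → ℂ
  x ^ s = exp (s * ofℝ (log x))

  -- ∑≤ x g is the sum of g n over the positive integers n ≤ x.
  ∑≤ : ℝ → (ℕ → ℂ) → ℂ
  ∑≤ x g = sum (map g (filter (λ n → fromℕ n ≤ᴿ? x) (positivesTo x)))

  -- Arithmetic functions are maps ℕ → ℂ whose value at 0 plays no role.
  partialSum : (ℕ → ℂ) → ℂ → ℕ → ℂ
  partialSum a s N = sum (map (λ n → a n * fromℕ n ^ (- s)) (applyUpTo suc N))

  ConvergentInHalfPlane : (ℕ → ℂ) → Set
  ConvergentInHalfPlane a =
    ∃[ σ ] (∀ s → σ <ᴿ re s → ∃[ l ] partialSum a s ⟶ l)

  RepresentedInHalfPlane : (ℂ → ℂ) → (ℕ → ℂ) → Set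
  RepresentedInHalfPlane f a =
    ∃[ σ ] (∀ s → σ <ᴿ re s → partialSum a s ⟶ f s)

  -- The sum of a u * b v over the positive integers u, v with u v = n.
  _⋆_ : (ℕ → ℂ) → (ℕ → ℂ) → ℕ → ℂ
  (a ⋆ b) n =
    sum (map (λ (u , v) → a u * b v)
             (filter (λ (u , v) → u ℕ.* v ℕₚ.≟ n)
                     (cartesianProduct (applyUpTo suc n) (applyUpTo suc n))))

  -- a ⟨ r ⟩ is a n if r equals the positive integer n, and 0 otherwise.
  _⟨_⟩ : (ℕ → ℂ) → ℝ → ℂ
  a ⟨ r ⟩ = maybe′ a 0ℂ (head (filter (λ n → fromℕ n ≟ᴿ r) (positivesTo r)))

  -- A relation f(s) = ∑_{n≤x} a(n) n^{-s} + ψ(s) ∑_{n≤y} b(n) n^{s-δ} + E(s,x)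
  -- with y = T(s)/x, valid for s in the region Ω and all real x > 0.  The
  -- remainder E is attached to T; a T₁ that also depends on x₂, or a T₂ on x₁,
  -- is covered by letting the whole record depend on that number.
  record Relation (δ : ℂ) (Ω : Pred ℂ 0ℓ) : Set where
    field
      f ψ      : ℂ → ℂ
      a b      : ℕ → ℂ
      T        : ℂ → ℝ
      E        : ℂ → ℝ → ℂ
      f-series : RepresentedInHalfPlane f a
      b-series : ConvergentInHalfPlane b
      T-nonNeg : ∀ s → Ω s → 0# ≤ᴿ T s
      relation : ∀ s → Ω s → ∀ x → 0# <ᴿ x →
                 f s ≡ ∑≤ x (λ n → a n * fromℕ n ^ (- s))
                       + ψ s * ∑≤ (T s /ᴿ x) (λ n → b n * fromℕ n ^ (s - δ))
                       + E s x

  module _ {δ : ℂ} {Ω : Pred ℂ 0ℓ} (F : Relation δ Ω) where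
    open Relation F

    FunctionalEquation : Set
    FunctionalEquation = ∀ s → Ω s → Ω (δ - s) → f s ≡ ψ s * f (δ - s)

    -- What a functional equation of f with itself presupposes about the
    -- relation: the dual series is the series of f and T is symmetric.
    -- Applying the functional equation at s and at δ - s gives
    -- f s ≡ (ψ s * ψ (δ - s)) * f s, hence ψ s * ψ (δ - s) ≡ 1ℂ unless f s
    -- vanishes.  For meromorphic f and ψ this extends to the zeros of f by
    -- continuity; for mere functions it has to be required there.
    record SelfDual : Set where
      field
        b≡a     : ∀ n → b (suc n) ≡ a (suc n)
        T-sym   : ∀ s → Ω s → Ω (δ - s) → T (δ - s) ≡ T s
        ψ-zeros : ∀ s → Ω s → Ω (δ - s) → f s ≡ 0ℂ → ψ s * ψ (δ - s) ≡ 1ℂ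

  -- When yᵢ = 0 the quotients by yᵢ below are junk values, but they occur only
  -- in, or as factors of, sums over n ≤ yᵢ, which are then empty.
  module Product {δ : ℂ} {Ω : Pred ℂ 0ℓ} (F₁ F₂ : Relation δ Ω)
                 (s : ℂ) (x₁ x₂ : ℝ) where
    open Relation F₁ public
      using () renaming (f to f₁; ψ to ψ₁; a to a₁; b to b₁; T to T₁; E to E₁)
    open Relation F₂ public
      using () renaming (f to f₂; ψ to ψ₂; a to a₂; b to b₂; T to T₂; E to E₂)

    y₁ y₂ ℓ₁ ℓ₂ : ℝ
    y₁ = T₁ s /ᴿ x₁
    y₂ = T₂ s /ᴿ x₂
    ℓ₁ = x₁ /ᴿ y₂
    ℓ₂ = x₂ /ᴿ y₁

    A B : ℕ → ℂ
    A = a₁ ⋆ a₂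
    B = b₁ ⋆ b₂

    I₁ I₂ I₃ I₄ I₅ L₁ L₂ E₁₂ : ℂ
    I₁ = ∑≤ x₁ (λ n → a₁ n * fromℕ n ^ (- s) * E₂ s (x₁ *ᴿ x₂ /ᴿ fromℕ n))
    I₂ = ∑≤ x₂ (λ n → a₂ n * fromℕ n ^ (- s) * E₁ s (x₁ *ᴿ x₂ /ᴿ fromℕ n))
    I₃ = ψ₁ s * ∑≤ y₁ (λ m → b₁ m * fromℕ m ^ (s - δ) * E₂ s (fromℕ m *ᴿ x₂ /ᴿ y₁))
    I₄ = ψ₂ s * ∑≤ y₂ (λ m → b₂ m * fromℕ m ^ (s - δ) * E₁ s (fromℕ m *ᴿ x₁ /ᴿ y₂))
    I₅ = E₁ s x₁ * E₂ s x₂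
    L₁ = ψ₁ s * ℓ₂ ^ (- s) * ∑≤ y₁ (λ m → b₁ m * a₂ ⟨ ℓ₂ *ᴿ fromℕ m ⟩ * fromℕ m ^ (- δ))
    L₂ = ψ₂ s * ℓ₁ ^ (- s) * ∑≤ y₂ (λ n → b₂ n * a₁ ⟨ ℓ₁ *ᴿ fromℕ n ⟩ * fromℕ n ^ (- δ))
    E₁₂ = I₁ + I₂ + I₃ + I₄ + I₅ + L₁ + L₂

{-# OPTIONS --safe #-}

-- Multiply out P₁ f₂ + P₂ f₁ + ψ₁ Q₁ f₂ + ψ₂ Q₂ f₁, where Pᵢ and Qᵢ are the two
-- sums in the relation for fᵢ, and inside each sum replace fⱼ by its relation
-- at a point adapted to the summation variable: x₁x₂/n for Pᵢ, and m x₂/y₁,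
-- m x₁/y₂ for Q₁, Q₂.  The remainders give I₁, …, I₄.  The a·a and b·b double
-- sums combine by Dirichlet's hyperbola method to the sums of A and B.  The a·b
-- double sums cover a rectangle by its two parts above and below a line through
-- the origin; lattice points on the line are counted twice and give L₁ and L₂.
-- What is left over cancels against the expansion of f₁ f₂, except for E₁ E₂.
--
-- With functional equations, ψ(s) ψ(δ-s) = 1, and comparing the relation at
-- (s, x) with the one at (δ-s, T/x) gives E(s, x) = ψ(s) E(δ-s, T/x).

module Submission where

open import Defs
open import Algebra.Consequences.Propositional using (comm∧idˡ⇒id; comm∧invˡ⇒inv; comm∧distrˡ⇒distr)
open import Algebra.Core using (Op₁; Op₂)
open import Algebra.Bundles using (CommutativeRing)
open import Algebra.Structures using (IsCommutativeRing)
import Algebra.Properties.Ring as RingProperties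
import Algebra.Solver.Ring.NaturalCoefficients.Default as NaturalCoefficients
open import Data.Bool.Base using (if_then_else_)
open import Data.Empty using (⊥-elim)
open import Data.List.Base using (List; []; _∷_; _++_; _∷ʳ_; map; foldr; filter; head; applyUpTo; cartesianProduct)
open import Data.List.Membership.Propositional using (_∈_)
open import Data.List.Membership.Propositional.Properties using (∈-applyUpTo⁻)
open import Data.List.Properties using (applyUpTo-∷ʳ)
open import Data.List.Relation.Unary.All as All using ()
open import Data.List.Relation.Unary.AllPairs.Core using (_∷_)
open import Data.List.Relation.Unary.Any using (here; there)
open import Data.List.Relation.Unary.Unique.Propositional using (Unique)
open import Data.List.Relation.Unary.Unique.Propositional.Properties using (applyUpTo⁺₁)
open import Data.Maybe.Base using (maybe′)
import Data.Nat.Base as ℕ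
open ℕ using (ℕ; zero; suc; NonZero)
import Data.Nat.Properties as ℕₚ
open import Data.Product.Base using (∃-syntax; _×_; _,_; proj₁; proj₂)
open import Data.Sum.Base using (_⊎_; inj₁; inj₂)
open import Function.Base using (_∘_)
open import Level using (0ℓ)
open import Relation.Binary.PropositionalEquality
open import Relation.Binary.Definitions using (DecidableEquality)
open import Relation.Binary.Structures using (IsDecTotalOrder)
open import Relation.Unary using (Pred)
open import Relation.Nullary using (Dec; does; ¬_; yes; no)
open import Relation.Nullary.Decidable using (_×-dec_; _⊎-dec_)

-- The adapted points are dictated by the lengths of the dual sums. At x₁x₂/n the dual sum of f₂ has
-- length y₂n/x₁, so the a·a pairs fill a region under a hyperbola while the a·b pairs are cut off
-- by a line. At mx₁/y₂ the roles are exchanged: the dual sum of f₁ has length y₁y₂/m, a hyperbola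
-- for the b·b pairs, and the a-sum has length mx₁/y₂, cut off by the same line from the other side.
-- This is why the pieces fit together. The obstacle is that inner lengths vary with the outer
-- variable, and that each range is cut from a list with an arbitrary upper bound. All double sums
-- are therefore placed on one common square, with regions expressed by indicators. The regions
-- overlap, so they are compared in pairs: two pairs of conditions count every lattice point equally
-- often once their unions and their intersections agree. The powers are hidden in the coefficients
-- until the end, so this part holds in any commutative ring, and of the exponential only its
-- multiplicativity is needed.

-- Arithmetic and order in an ordered field.

module OrderedFieldProperties (R : CompleteOrderedField) where
  open CompleteOrderedField R
  open IsDecTotalOrder isDecTotalOrder public
    using () renaming (refl to ≤-refl; reflexive to ≤-reflexive; trans to ≤-trans; antisym to ≤-antisym; total to ≤-total)

  commutativeRing : CommutativeRing 0ℓ 0ℓ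
  commutativeRing = record { isCommutativeRing = isCommutativeRing }

  open CommutativeRing commutativeRing public
    using ( +-assoc; +-comm; +-identityˡ; +-identityʳ; -‿inverseˡ; -‿inverseʳ
          ; *-assoc; *-comm; *-identityˡ; *-identityʳ; distribˡ; distribʳ; zeroˡ; zeroʳ
          ; ring; commutativeSemiring)
  open RingProperties ring public using (-‿distribˡ-*; -‿distribʳ-*; -‿involutive; -0#≈0#)
  open NaturalCoefficients commutativeSemiring public using (solve; _:=_; _:+_; _:*_)

  0≤y-x : ∀ {x y} → x ≤ y → 0# ≤ y - x
  0≤y-x {x} {y} x≤y = subst₂ _≤_ (-‿inverseˡ x) (+-comm (- x) y) (+-monoʳ-≤ (- x) x≤y)

  0≤y-x⇒x≤y : ∀ {x y} → 0# ≤ y - x → x ≤ y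
  0≤y-x⇒x≤y {x} {y} 0≤d = subst₂ _≤_ (+-identityʳ x) eq (+-monoʳ-≤ x 0≤d)
    where
    open ≡-Reasoning
    eq : x + (y - x) ≡ y
    eq = begin
      x + (y + - x)  ≡⟨ cong (x +_) (+-comm y (- x)) ⟩
      x + (- x + y)  ≡⟨ +-assoc x (- x) y ⟨
      (x + - x) + y  ≡⟨ cong (_+ y) (-‿inverseʳ x) ⟩
      0# + y         ≡⟨ +-identityˡ y ⟩
      y              ∎

  *-monoʳ-≤ : ∀ {x y z} → 0# ≤ z → x ≤ y → x * z ≤ y * z
  *-monoʳ-≤ {x} {y} {z} 0≤z x≤y = 0≤y-x⇒x≤y (subst (0# ≤_) eq (*-nonNegative (0≤y-x x≤y) 0≤z))
    where
    eq : (y - x) * z ≡ y * z - x * z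
    eq = trans (distribʳ z y (- x)) (cong (y * z +_) (sym (-‿distribˡ-* x z)))

  *-monoˡ-≤ : ∀ {x y z} → 0# ≤ z → x ≤ y → z * x ≤ z * y
  *-monoˡ-≤ {x} {y} {z} 0≤z x≤y = subst₂ _≤_ (*-comm x z) (*-comm y z) (*-monoʳ-≤ 0≤z x≤y)

  ≰⇒> : ∀ {x y} → ¬ x ≤ y → y < x
  ≰⇒> {x} {y} x≰y with ≤-total x y
  ... | inj₁ x≤y = ⊥-elim (x≰y x≤y)
  ... | inj₂ y≤x = y≤x , λ { refl → x≰y ≤-refl }

  <⇒≱ : ∀ {x y} → x < y → ¬ y ≤ x
  <⇒≱ (x≤y , x≢y) y≤x = x≢y (≤-antisym x≤y y≤x)

  ≤-<-trans : ∀ {x y z} → x ≤ y → y < z → x < z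
  ≤-<-trans x≤y y<z = ≤-trans x≤y (proj₁ y<z) , λ { refl → <⇒≱ y<z x≤y }

  <-≤-trans : ∀ {x y z} → x < y → y ≤ z → x < z
  <-≤-trans x<y y≤z = ≤-trans (proj₁ x<y) y≤z , λ { refl → <⇒≱ x<y y≤z }

  0≤x² : ∀ x → 0# ≤ x * x
  0≤x² x with ≤-total 0# x
  ... | inj₁ 0≤x = *-nonNegative 0≤x 0≤x
  ... | inj₂ x≤0 = subst (0# ≤_) eq (*-nonNegative 0≤-x 0≤-x)
    where
    0≤-x : 0# ≤ - x
    0≤-x = subst (0# ≤_) (+-identityˡ (- x)) (0≤y-x x≤0)
    eq : - x * - x ≡ x * x
    eq = trans (sym (-‿distribˡ-* x (- x))) (trans (cong -_ (sym (-‿distribʳ-* x x))) (-‿involutive (x * x)))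

  0<1 : 0# < 1#
  0<1 = subst (0# ≤_) (*-identityˡ 1#) (0≤x² 1#) , 0≢1

  <⇒≢0 : ∀ {x} → 0# < x → x ≢ 0#
  <⇒≢0 (_ , 0≢x) x≡0 = 0≢x (sym x≡0)

  x≤1+x : ∀ x → x ≤ 1# + x
  x≤1+x x = subst₂ _≤_ (+-identityʳ x) (+-comm x 1#) (+-monoʳ-≤ x (proj₁ 0<1))

  *-inverseʳ : ∀ {x} → 0# < x → x * x ⁻¹ ≡ 1#
  *-inverseʳ 0<x = ⁻¹-inverseʳ _ (<⇒≢0 0<x)

  *-/-cancel : ∀ x {c} → c ≢ 0# → (x * c) / c ≡ x
  *-/-cancel x {c} c≢0 = trans (*-assoc x c (c ⁻¹)) (trans (cong (x *_) (⁻¹-inverseʳ c c≢0)) (*-identityʳ x))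

  /-*-cancel : ∀ x {c} → 0# < c → (x / c) * c ≡ x
  /-*-cancel x {c} 0<c = trans (*-assoc x (c ⁻¹) c) (trans (cong (x *_) (trans (*-comm (c ⁻¹) c) (*-inverseʳ 0<c))) (*-identityʳ x))

  *-cancelʳ : ∀ {x y c} → c ≢ 0# → x * c ≡ y * c → x ≡ y
  *-cancelʳ {x} {y} {c} c≢0 eq = trans (sym (*-/-cancel x c≢0)) (trans (cong (_/ c) eq) (*-/-cancel y c≢0))

  *-cancelʳ-≤ : ∀ {x y c} → 0# < c → x * c ≤ y * c → x ≤ y
  *-cancelʳ-≤ {x} {y} {c} 0<c xc≤yc with ≤-total x y
  ... | inj₁ x≤y = x≤y
  ... | inj₂ y≤x = ≤-reflexive (*-cancelʳ (<⇒≢0 0<c) (≤-antisym xc≤yc (*-monoʳ-≤ (proj₁ 0<c) y≤x)))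

  ≤/⇒*≤ : ∀ {x y c} → 0# < c → x ≤ y / c → x * c ≤ y
  ≤/⇒*≤ {x} {y} 0<c x≤y/c = subst (x * _ ≤_) (/-*-cancel y 0<c) (*-monoʳ-≤ (proj₁ 0<c) x≤y/c)

  *≤⇒≤/ : ∀ {x y c} → 0# < c → x * c ≤ y → x ≤ y / c
  *≤⇒≤/ {x} {y} 0<c xc≤y = *-cancelʳ-≤ 0<c (subst (x * _ ≤_) (sym (/-*-cancel y 0<c)) xc≤y)

  x*0<c⇒x>0 : ∀ {x c} → 0# < c → 0# < x * c → 0# < x
  x*0<c⇒x>0 {x} {c} 0<c (0≤xc , 0≢xc) =
    *-cancelʳ-≤ 0<c (subst (_≤ x * c) (sym (zeroˡ c)) 0≤xc) , λ { refl → 0≢xc (sym (zeroˡ c)) }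

  *-positive : ∀ {x y} → 0# < x → 0# < y → 0# < x * y
  *-positive {x} {y} 0<x 0<y =
    *-nonNegative (proj₁ 0<x) (proj₁ 0<y) ,
    λ 0≡xy → proj₂ 0<x (*-cancelʳ (<⇒≢0 0<y) (trans (zeroˡ y) 0≡xy))

  /-positive : ∀ {x c} → 0# < x → 0# < c → 0# < x / c
  /-positive {x} {c} 0<x 0<c = x*0<c⇒x>0 0<c (subst (0# <_) (sym (/-*-cancel x 0<c)) 0<x)

  /-nonNegative : ∀ {x c} → 0# ≤ x → 0# < c → 0# ≤ x / c
  /-nonNegative {x} {c} 0≤x 0<c = *≤⇒≤/ 0<c (subst (_≤ x) (sym (zeroˡ c)) 0≤x)

  *-mono-≤ : ∀ {x y u v} → 0# ≤ u → 0# ≤ y → x ≤ y → u ≤ v → x * u ≤ y * v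
  *-mono-≤ 0≤u 0≤y x≤y u≤v = ≤-trans (*-monoʳ-≤ 0≤u x≤y) (*-monoˡ-≤ 0≤y u≤v)

  *-mono-< : ∀ {x y u v} → 0# ≤ x → 0# ≤ u → x < y → u < v → x * u < y * v
  *-mono-< {x} {y} {u} {v} 0≤x 0≤u x<y u<v =
    ≤-<-trans (*-monoˡ-≤ 0≤x (proj₁ u<v))
      (*-monoʳ-≤ (proj₁ 0<v) (proj₁ x<y) , λ xv≡yv → proj₂ x<y (*-cancelʳ (<⇒≢0 0<v) xv≡yv))
    where
    0<v : 0# < v
    0<v = ≤-<-trans 0≤u u<v

  -- The natural numbers inside the reals.

  fromℕ-nonNegative : ∀ n → 0# ≤ fromℕ n
  fromℕ-nonNegative zero    = ≤-refl
  fromℕ-nonNegative (suc n) = ≤-trans (fromℕ-nonNegative n) (x≤1+x (fromℕ n))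

  1≤fromℕ : ∀ n .⦃ _ : NonZero n ⦄ → 1# ≤ fromℕ n
  1≤fromℕ (suc n) = subst (_≤ 1# + fromℕ n) (+-identityʳ 1#) (+-monoʳ-≤ 1# (fromℕ-nonNegative n))

  fromℕ-positive : ∀ n .⦃ _ : NonZero n ⦄ → 0# < fromℕ n
  fromℕ-positive n = <-≤-trans 0<1 (1≤fromℕ n)

  fromℕ-mono-≤ : ∀ {m n} → m ℕ.≤ n → fromℕ m ≤ fromℕ n
  fromℕ-mono-≤ {n = n} ℕ.z≤n = fromℕ-nonNegative n
  fromℕ-mono-≤ (ℕ.s≤s m≤n)   = +-monoʳ-≤ 1# (fromℕ-mono-≤ m≤n)

  x<1+x : ∀ x → x < 1# + x
  x<1+x x = x≤1+x x , λ x≡1+x → 0≢1 (begin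
      0#              ≡⟨ -‿inverseʳ x ⟨
      x - x           ≡⟨ cong (_- x) x≡1+x ⟩
      (1# + x) - x    ≡⟨ +-assoc 1# x (- x) ⟩
      1# + (x - x)    ≡⟨ cong (1# +_) (-‿inverseʳ x) ⟩
      1# + 0#         ≡⟨ +-identityʳ 1# ⟩
      1#              ∎)
    where open ≡-Reasoning

  fromℕ-mono-< : ∀ {m n} → m ℕ.< n → fromℕ m < fromℕ n
  fromℕ-mono-< {m} m<n = <-≤-trans (x<1+x (fromℕ m)) (fromℕ-mono-≤ m<n)

  fromℕ-cancel-≤ : ∀ {m n} → fromℕ m ≤ fromℕ n → m ℕ.≤ n
  fromℕ-cancel-≤ m≤n = ℕₚ.≮⇒≥ λ n<m → <⇒≱ (fromℕ-mono-< n<m) m≤n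

  fromℕ-injective : ∀ {m n} → fromℕ m ≡ fromℕ n → m ≡ n
  fromℕ-injective eq = ℕₚ.≤-antisym (fromℕ-cancel-≤ (≤-reflexive eq)) (fromℕ-cancel-≤ (≤-reflexive (sym eq)))

  fromℕ-+ : ∀ m n → fromℕ (m ℕ.+ n) ≡ fromℕ m + fromℕ n
  fromℕ-+ zero    n = sym (+-identityˡ (fromℕ n))
  fromℕ-+ (suc m) n = trans (cong (1# +_) (fromℕ-+ m n)) (sym (+-assoc 1# (fromℕ m) (fromℕ n)))

  fromℕ-* : ∀ m n → fromℕ (m ℕ.* n) ≡ fromℕ m * fromℕ n
  fromℕ-* zero    n = sym (zeroˡ (fromℕ n))
  fromℕ-* (suc m) n = begin
    fromℕ (n ℕ.+ m ℕ.* n)              ≡⟨ fromℕ-+ n (m ℕ.* n) ⟩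
    fromℕ n + fromℕ (m ℕ.* n)          ≡⟨ cong (fromℕ n +_) (fromℕ-* m n) ⟩
    fromℕ n + fromℕ m * fromℕ n        ≡⟨ cong (_+ fromℕ m * fromℕ n) (*-identityˡ (fromℕ n)) ⟨
    1# * fromℕ n + fromℕ m * fromℕ n   ≡⟨ distribʳ (fromℕ n) 1# (fromℕ m) ⟨
    (1# + fromℕ m) * fromℕ n           ∎
    where open ≡-Reasoning

  -- One computation serves both kinds of adapted point. With `n` as summation variable the dual
  -- length grows linearly, which gives the line; with `x` as summation variable it is inversely
  -- proportional to it, which gives the hyperbola.
  dual-length : ∀ T {x y n} → 0# < x → 0# < y → 0# < n → T / ((x * y) / n) ≡ ((T / y) * n) / x
  dual-length T {x} {y} {n} 0<x 0<y 0<n = *-cancelʳ (<⇒≢0 0<z) (trans (/-*-cancel T 0<z) (sym eq))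
    where
    open ≡-Reasoning
    0<z : 0# < (x * y) / n
    0<z = /-positive (*-positive 0<x 0<y) 0<n
    eq : (((T / y) * n) / x) * ((x * y) / n) ≡ T
    eq = begin
      (((T * y ⁻¹) * n) * x ⁻¹) * ((x * y) * n ⁻¹)
        ≡⟨ solve 7 (λ T x y n x' y' n' → (((T :* y') :* n) :* x') :* ((x :* y) :* n') := T :* (x :* x') :* (y :* y') :* (n :* n')) refl T x y n (x ⁻¹) (y ⁻¹) (n ⁻¹) ⟩
      T * (x * x ⁻¹) * (y * y ⁻¹) * (n * n ⁻¹)
        ≡⟨ cong₂ _*_ (cong₂ _*_ (cong (T *_) (*-inverseʳ 0<x)) (*-inverseʳ 0<y)) (*-inverseʳ 0<n) ⟩
      T * 1# * 1# * 1#
        ≡⟨ trans (*-identityʳ _) (trans (*-identityʳ _) (*-identityʳ T)) ⟩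
      T ∎

-- Finite sums with values in a commutative ring.

module Summation (R : CompleteOrderedField) {K : Set}
                 {_⊕_ _⊗_ : Op₂ K} {⊖_ : Op₁ K} {0ᴷ 1ᴷ : K}
                 (isCommutativeRing : IsCommutativeRing _≡_ _⊕_ _⊗_ ⊖_ 0ᴷ 1ᴷ) where
  private module R = CompleteOrderedField R
  open R
    using (ℝ; fromℕ; positivesTo; archimedean; _≤_; _<_; _≤?_; _≟_; _/_)
    renaming (_*_ to _*ᴿ_; 0# to 0ᴿ)
  module ℝₚ = OrderedFieldProperties R

  private
    commutativeRing : CommutativeRing 0ℓ 0ℓ
    commutativeRing = record { isCommutativeRing = isCommutativeRing }

  open CommutativeRing commutativeRing
    using ( _+_; _*_; 0#; 1#; +-assoc; +-comm; +-identityˡ; +-identityʳ; *-assoc; *-comm; *-identityˡ; *-identityʳ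
          ; distribˡ; distribʳ; zeroˡ; zeroʳ; ring; commutativeSemiring)
  open RingProperties ring using (+-cancelʳ)
  open NaturalCoefficients commutativeSemiring using (solve; _:=_; _:+_; _:*_)
  open ≡-Reasoning

  -- Sums over lists

  ∑∈ : ∀ {A : Set} → List A → (A → K) → K
  ∑∈ xs g = foldr _+_ 0# (map g xs)

  module _ {A : Set} where
    ∑∈-cong : ∀ (xs : List A) {g h : A → K} → (∀ {x} → x ∈ xs → g x ≡ h x) → ∑∈ xs g ≡ ∑∈ xs h
    ∑∈-cong []       g≡h = refl
    ∑∈-cong (x ∷ xs) g≡h = cong₂ _+_ (g≡h (here refl)) (∑∈-cong xs (g≡h ∘ there))

    ∑∈-zero : ∀ (xs : List A) {g : A → K} → (∀ {x} → x ∈ xs → g x ≡ 0#) → ∑∈ xs g ≡ 0#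
    ∑∈-zero []       g≡0 = refl
    ∑∈-zero (x ∷ xs) g≡0 = trans (cong₂ _+_ (g≡0 (here refl)) (∑∈-zero xs (g≡0 ∘ there))) (+-identityˡ 0#)

    ∑∈-+ : ∀ (xs : List A) (g h : A → K) → ∑∈ xs (λ x → g x + h x) ≡ ∑∈ xs g + ∑∈ xs h
    ∑∈-+ []       g h = sym (+-identityˡ 0#)
    ∑∈-+ (x ∷ xs) g h = trans (cong ((g x + h x) +_) (∑∈-+ xs g h))
      (solve 4 (λ a b c d → (a :+ b) :+ (c :+ d) := (a :+ c) :+ (b :+ d)) refl (g x) (h x) (∑∈ xs g) (∑∈ xs h))

    *-∑∈ : ∀ c (xs : List A) (g : A → K) → c * ∑∈ xs g ≡ ∑∈ xs (λ x → c * g x)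
    *-∑∈ c []       g = zeroʳ c
    *-∑∈ c (x ∷ xs) g = trans (distribˡ c (g x) (∑∈ xs g)) (cong (c * g x +_) (*-∑∈ c xs g))

    ∑∈-++ : ∀ (xs ys : List A) (g : A → K) → ∑∈ (xs ++ ys) g ≡ ∑∈ xs g + ∑∈ ys g
    ∑∈-++ []       ys g = sym (+-identityˡ (∑∈ ys g))
    ∑∈-++ (x ∷ xs) ys g = trans (cong (g x +_) (∑∈-++ xs ys g)) (sym (+-assoc (g x) (∑∈ xs g) (∑∈ ys g)))

  ∑∈-comm : ∀ {A B : Set} (xs : List A) (ys : List B) (g : A → B → K) →
            ∑∈ xs (λ x → ∑∈ ys (g x)) ≡ ∑∈ ys (λ y → ∑∈ xs (λ x → g x y))
  ∑∈-comm []       ys g = sym (∑∈-zero ys (λ _ → refl))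
  ∑∈-comm (x ∷ xs) ys g = trans (cong (∑∈ ys (g x) +_) (∑∈-comm xs ys g)) (sym (∑∈-+ ys (g x) (λ y → ∑∈ xs (λ x → g x y))))

  ∑∈-map : ∀ {A B : Set} (f : A → B) (xs : List A) (g : B → K) → ∑∈ (map f xs) g ≡ ∑∈ xs (g ∘ f)
  ∑∈-map f []       g = refl
  ∑∈-map f (x ∷ xs) g = cong (g (f x) +_) (∑∈-map f xs g)

  ∑∈-cartesianProduct : ∀ {A B : Set} (xs : List A) (ys : List B) (g : A × B → K) →
                        ∑∈ (cartesianProduct xs ys) g ≡ ∑∈ xs (λ x → ∑∈ ys (λ y → g (x , y)))
  ∑∈-cartesianProduct []       ys g = refl
  ∑∈-cartesianProduct (x ∷ xs) ys g =
    trans (∑∈-++ (map (x ,_) ys) (cartesianProduct xs ys) g)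
          (cong₂ _+_ (∑∈-map (x ,_) ys g) (∑∈-cartesianProduct xs ys g))

  -- Indicators of decidable conditions.

  𝟙 : ∀ {P : Set} → Dec P → K
  𝟙 d = if does d then 1# else 0#

  𝟙-cong : ∀ {P Q : Set} (p : Dec P) (q : Dec Q) → (P → Q) → (Q → P) → 𝟙 p ≡ 𝟙 q
  𝟙-cong (yes p) (yes q) _ _ = refl
  𝟙-cong (yes p) (no ¬q) f _ = ⊥-elim (¬q (f p))
  𝟙-cong (no ¬p) (yes q) _ g = ⊥-elim (¬p (g q))
  𝟙-cong (no ¬p) (no ¬q) _ _ = refl

  𝟙-guard : ∀ {P : Set} (p : Dec P) {g h : K} → (P → g ≡ h) → 𝟙 p * g ≡ 𝟙 p * h
  𝟙-guard (yes p) g≡h = cong (1# *_) (g≡h p)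
  𝟙-guard (no ¬p) {g} {h} _ = trans (zeroˡ g) (sym (zeroˡ h))

  𝟙-no : ∀ {P : Set} (p : Dec P) (g : K) → ¬ P → 𝟙 p * g ≡ 0#
  𝟙-no (yes p) g ¬p = ⊥-elim (¬p p)
  𝟙-no (no _)  g _  = zeroˡ g

  𝟙-× : ∀ {P Q : Set} (p : Dec P) (q : Dec Q) → 𝟙 (p ×-dec q) ≡ 𝟙 p * 𝟙 q
  𝟙-× (yes p) (yes q) = sym (*-identityˡ 1#)
  𝟙-× (yes p) (no ¬q) = sym (zeroʳ 1#)
  𝟙-× (no ¬p) q       = sym (zeroˡ (𝟙 q))

  𝟙-+ : ∀ {P Q : Set} (p : Dec P) (q : Dec Q) → 𝟙 p + 𝟙 q ≡ 𝟙 (p ⊎-dec q) + 𝟙 (p ×-dec q)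
  𝟙-+ (yes p) (yes q) = refl
  𝟙-+ (yes p) (no ¬q) = refl
  𝟙-+ (no ¬p) q       = +-comm 0# (𝟙 q)

  -- Inclusion and exclusion: the sum of two indicators depends only on the union and the
  -- intersection of the conditions. Both lattice point arguments below reduce to four implications
  -- through this lemma.
  𝟙-+-cong : ∀ {P Q P′ Q′ : Set} (p : Dec P) (q : Dec Q) (p′ : Dec P′) (q′ : Dec Q′) →
             (P ⊎ Q → P′ ⊎ Q′) → (P′ ⊎ Q′ → P ⊎ Q) → (P × Q → P′ × Q′) → (P′ × Q′ → P × Q) →
             𝟙 p + 𝟙 q ≡ 𝟙 p′ + 𝟙 q′
  𝟙-+-cong p q p′ q′ f g h k = begin
    𝟙 p + 𝟙 q                              ≡⟨ 𝟙-+ p q ⟩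
    𝟙 (p ⊎-dec q) + 𝟙 (p ×-dec q)          ≡⟨ cong₂ _+_ (𝟙-cong (p ⊎-dec q) (p′ ⊎-dec q′) f g) (𝟙-cong (p ×-dec q) (p′ ×-dec q′) h k) ⟩
    𝟙 (p′ ⊎-dec q′) + 𝟙 (p′ ×-dec q′)      ≡⟨ 𝟙-+ p′ q′ ⟨
    𝟙 p′ + 𝟙 q′                            ∎

  0*x+y≡y : ∀ x y → 0# * x + y ≡ y
  0*x+y≡y x y = trans (cong (_+ y) (zeroˡ x)) (+-identityˡ y)

  ∑∈-filter : ∀ {A : Set} {P : A → Set} (P? : ∀ x → Dec (P x)) (xs : List A) (g : A → K) →
              ∑∈ (filter P? xs) g ≡ ∑∈ xs (λ x → 𝟙 (P? x) * g x)
  ∑∈-filter P? []       g = refl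
  ∑∈-filter P? (x ∷ xs) g with P? x
  ... | yes _ = cong₂ _+_ (sym (*-identityˡ (g x))) (∑∈-filter P? xs g)
  ... | no  _ = trans (∑∈-filter P? xs g) (sym (0*x+y≡y (g x) _))

  -- The condition determines the element and the list has no repetitions, so after the first hit
  -- all further terms of the sum vanish.
  head-filter : ∀ {A : Set} {P : A → Set} (P? : ∀ x → Dec (P x)) → (∀ {x y} → P x → P y → x ≡ y) →
                ∀ (g : A → K) {xs} → Unique xs → maybe′ g 0# (head (filter P? xs)) ≡ ∑∈ xs (λ x → 𝟙 (P? x) * g x)
  head-filter P? P! g {[]}     _ = refl
  head-filter P? P! g {x ∷ xs} (x∉xs ∷ xs!) with P? x
  ... | no  _  = trans (head-filter P? P! g xs!) (sym (0*x+y≡y (g x) _))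
  ... | yes px = sym (trans (cong₂ _+_ (*-identityˡ (g x)) rest) (+-identityʳ (g x)))
    where
    rest : ∑∈ xs (λ y → 𝟙 (P? y) * g y) ≡ 0#
    rest = ∑∈-zero xs λ {y} y∈xs → 𝟙-no (P? y) (g y) λ py → All.lookup x∉xs y∈xs (P! px py)

  -- Sums over initial segments of the positive integers

  ∑ : ℕ → (ℕ → K) → K
  ∑ N = ∑∈ (applyUpTo suc N)

  -- Entries of the list have the form `suc i`; this supplies the `NonZero` instance on which later
  -- divisions by the summation variable rely.
  ∑-cong′ : ∀ N {g h : ℕ → K} → (∀ n .⦃ _ : NonZero n ⦄ → n ℕ.≤ N → g n ≡ h n) → ∑ N g ≡ ∑ N h
  ∑-cong′ N g≡h = ∑∈-cong (applyUpTo suc N) λ n∈ → helper (∈-applyUpTo⁻ suc n∈)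
    where
    helper : ∀ {n} → ∃[ i ] i ℕ.< N × n ≡ suc i → _
    helper (i , i<N , refl) = g≡h (suc i) i<N

  ∑-cong : ∀ N {g h : ℕ → K} → (∀ n .⦃ _ : NonZero n ⦄ → g n ≡ h n) → ∑ N g ≡ ∑ N h
  ∑-cong N g≡h = ∑-cong′ N (λ n _ → g≡h n)

  ∑-zero : ∀ N {g : ℕ → K} → (∀ n .⦃ _ : NonZero n ⦄ → n ℕ.≤ N → g n ≡ 0#) → ∑ N g ≡ 0#
  ∑-zero N g≡0 = trans (∑-cong′ N g≡0) (∑∈-zero (applyUpTo suc N) (λ _ → refl))

  ∑-+ : ∀ N (g h : ℕ → K) → ∑ N (λ n → g n + h n) ≡ ∑ N g + ∑ N h
  ∑-+ N = ∑∈-+ (applyUpTo suc N)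

  *-∑ : ∀ c N (g : ℕ → K) → c * ∑ N g ≡ ∑ N (λ n → c * g n)
  *-∑ c N = *-∑∈ c (applyUpTo suc N)

  ∑-comm : ∀ M N (g : ℕ → ℕ → K) → ∑ M (λ m → ∑ N (g m)) ≡ ∑ N (λ n → ∑ M (λ m → g m n))
  ∑-comm M N = ∑∈-comm (applyUpTo suc M) (applyUpTo suc N)

  ∑-suc : ∀ N (g : ℕ → K) → ∑ (suc N) g ≡ ∑ N g + g (suc N)
  ∑-suc N g = begin
    ∑∈ (applyUpTo suc (suc N)) g           ≡⟨ cong (λ xs → ∑∈ xs g) (applyUpTo-∷ʳ suc N) ⟨
    ∑∈ (applyUpTo suc N ∷ʳ suc N) g        ≡⟨ ∑∈-++ (applyUpTo suc N) (suc N ∷ []) g ⟩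
    ∑ N g + (g (suc N) + 0#)               ≡⟨ cong (∑ N g +_) (+-identityʳ (g (suc N))) ⟩
    ∑ N g + g (suc N)                      ∎

  ∑-extend′ : ∀ {M N} (g : ℕ → K) → M ℕ.≤′ N → (∀ n → M ℕ.< n → g n ≡ 0#) → ∑ M g ≡ ∑ N g
  ∑-extend′         g (ℕ.≤′-reflexive refl)  g≡0 = refl
  ∑-extend′ {M} {suc N} g (ℕ.≤′-step M≤N) g≡0 = begin
    ∑ M g              ≡⟨ ∑-extend′ g M≤N g≡0 ⟩
    ∑ N g              ≡⟨ +-identityʳ (∑ N g) ⟨
    ∑ N g + 0#         ≡⟨ cong (∑ N g +_) (g≡0 (suc N) (ℕ.s≤s (ℕₚ.≤′⇒≤ M≤N))) ⟨
    ∑ N g + g (suc N)  ≡⟨ ∑-suc N g ⟨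
    ∑ (suc N) g        ∎

  ∑-extend : ∀ {M N} (g : ℕ → K) → M ℕ.≤ N → (∀ n → M ℕ.< n → g n ≡ 0#) → ∑ M g ≡ ∑ N g
  ∑-extend g M≤N = ∑-extend′ g (ℕₚ.≤⇒≤′ M≤N)

  -- The bound supplied by `archimedean` is arbitrary and may lie on either side of a chosen one, so
  -- neither order of `M` and `N` can be assumed.
  ∑-support : ∀ M N (g : ℕ → K) → (∀ n → M ℕ.< n → g n ≡ 0#) → (∀ n → N ℕ.< n → g n ≡ 0#) → ∑ M g ≡ ∑ N g
  ∑-support M N g M-bound N-bound with ℕₚ.≤-total M N
  ... | inj₁ M≤N = ∑-extend g M≤N M-bound
  ... | inj₂ N≤M = sym (∑-extend g N≤M N-bound)

  ∑-δ : ∀ N (g : ℕ → K) k .⦃ _ : NonZero k ⦄ → k ℕ.≤ N → ∑ N (λ n → 𝟙 (k ℕₚ.≟ n) * g n) ≡ g k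
  ∑-δ zero    g (suc k) ()
  ∑-δ (suc N) g k k≤1+N = trans (∑-suc N h) (last (k ℕₚ.≟ suc N))
    where
    h : ℕ → K
    h n = 𝟙 (k ℕₚ.≟ n) * g n
    last : Dec (k ≡ suc N) → ∑ N h + h (suc N) ≡ g k
    last (yes refl) = trans (cong₂ _+_ (∑-zero N λ n n≤N → 𝟙-no (suc N ℕₚ.≟ n) (g n) λ { refl → ℕₚ.<-irrefl refl n≤N })
                                       (trans (cong (_* g (suc N)) (𝟙-cong (suc N ℕₚ.≟ suc N) (yes refl) (λ z → z) (λ _ → refl))) (*-identityˡ (g k))))
                            (+-identityˡ (g k))
    last (no k≢1+N) = trans (cong₂ _+_ (∑-δ N g k (ℕ.s≤s⁻¹ (ℕₚ.≤∧≢⇒< k≤1+N k≢1+N))) (𝟙-no (k ℕₚ.≟ suc N) (g (suc N)) k≢1+N))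
                            (+-identityʳ (g k))

  -- Sums up to a real bound, convolution and evaluation at a real.

  -- For the ring of complex numbers this sum, `_⋆_` and `_⟨_⟩` unfold to the notions in the
  -- statement, so the identities proved here apply there without conversion.
  ∑≤ : ℝ → (ℕ → K) → K
  ∑≤ x = ∑∈ (filter (λ n → fromℕ n ≤? x) (positivesTo x))

  beyond : ∀ {x N} → x ≤ fromℕ N → ∀ n → N ℕ.< n → ¬ fromℕ n ≤ x
  beyond x≤N n N<n n≤x = ℝₚ.<⇒≱ (ℝₚ.fromℕ-mono-< N<n) (ℝₚ.≤-trans n≤x x≤N)

  -- Terms beyond `x` carry a vanishing indicator, so the upper end can be any `N` above `x`. This
  -- is what lets sums of different lengths share one range.
  ∑≤≡∑ : ∀ {x} N (g : ℕ → K) → x ≤ fromℕ N → ∑≤ x g ≡ ∑ N (λ n → 𝟙 (fromℕ n ≤? x) * g n)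
  ∑≤≡∑ {x} N g x≤N = trans (∑∈-filter (λ n → fromℕ n ≤? x) (positivesTo x) g)
    (∑-support (proj₁ (archimedean x)) N _
      (λ n → 𝟙-no (fromℕ n ≤? x) (g n) ∘ beyond (proj₂ (archimedean x)) n)
      (λ n → 𝟙-no (fromℕ n ≤? x) (g n) ∘ beyond x≤N n))

  ∑≤-cong : ∀ x {g h : ℕ → K} → (∀ n .⦃ _ : NonZero n ⦄ → fromℕ n ≤ x → g n ≡ h n) → ∑≤ x g ≡ ∑≤ x h
  ∑≤-cong x {g} {h} g≡h = begin
    ∑≤ x g                               ≡⟨ ∑≤≡∑ N g x≤N ⟩
    ∑ N (λ n → 𝟙 (fromℕ n ≤? x) * g n)   ≡⟨ ∑-cong N (λ n → 𝟙-guard (fromℕ n ≤? x) (g≡h n)) ⟩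
    ∑ N (λ n → 𝟙 (fromℕ n ≤? x) * h n)   ≡⟨ ∑≤≡∑ N h x≤N ⟨
    ∑≤ x h                               ∎
    where
    N = proj₁ (archimedean x)
    x≤N = proj₂ (archimedean x)

  ∑≤-+ : ∀ x (g h : ℕ → K) → ∑≤ x (λ n → g n + h n) ≡ ∑≤ x g + ∑≤ x h
  ∑≤-+ x = ∑∈-+ (filter (λ n → fromℕ n ≤? x) (positivesTo x))

  *-∑≤ : ∀ c x (g : ℕ → K) → c * ∑≤ x g ≡ ∑≤ x (λ n → c * g n)
  *-∑≤ c x = *-∑∈ c (filter (λ n → fromℕ n ≤? x) (positivesTo x))

  ∑≤-* : ∀ x (g : ℕ → K) c → ∑≤ x (λ n → g n * c) ≡ ∑≤ x g * c
  ∑≤-* x g c = trans (∑≤-cong x (λ n _ → *-comm (g n) c)) (trans (sym (*-∑≤ c x g)) (*-comm c (∑≤ x g)))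

  _⋆_ : (ℕ → K) → (ℕ → K) → ℕ → K
  (α ⋆ β) n = ∑∈ (filter (λ (u , v) → u ℕ.* v ℕₚ.≟ n) (cartesianProduct (applyUpTo suc n) (applyUpTo suc n))) (λ (u , v) → α u * β v)

  _⟨_⟩ : (ℕ → K) → ℝ → K
  α ⟨ r ⟩ = maybe′ α 0# (head (filter (λ n → fromℕ n ≟ r) (positivesTo r)))

  -- Evaluation at a real that need not be an integer becomes a sum with an indicator, so the terms
  -- on the line can enter a double sum like any other region.
  ⟨⟩≡∑ : ∀ {r} N (α : ℕ → K) → r ≤ fromℕ N → α ⟨ r ⟩ ≡ ∑ N (λ n → 𝟙 (fromℕ n ≟ r) * α n)
  ⟨⟩≡∑ {r} N α r≤N = trans
    (head-filter (λ n → fromℕ n ≟ r) (λ m≡r n≡r → ℝₚ.fromℕ-injective (trans m≡r (sym n≡r))) α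
      (applyUpTo⁺₁ suc (proj₁ (archimedean r)) (λ i<j _ → ℕₚ.<⇒≢ (ℕ.s≤s i<j))))
    (∑-support (proj₁ (archimedean r)) N _
      (λ n N<n → 𝟙-no (fromℕ n ≟ r) (α n) (beyond (proj₂ (archimedean r)) n N<n ∘ ℝₚ.≤-reflexive))
      (λ n N<n → 𝟙-no (fromℕ n ≟ r) (α n) (beyond r≤N n N<n ∘ ℝₚ.≤-reflexive)))

  -- Only the positive integer equal to `r` matters, so `h` has to be known there alone; if there is
  -- no such integer, both sides are zero.
  ⟨⟩-* : ∀ {r} (g h : ℕ → K) {c} → (∀ n .⦃ _ : NonZero n ⦄ → fromℕ n ≡ r → h n ≡ c) → (λ n → g n * h n) ⟨ r ⟩ ≡ g ⟨ r ⟩ * c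
  ⟨⟩-* {r} g h {c} h≡c = begin
    (λ n → g n * h n) ⟨ r ⟩                      ≡⟨ ⟨⟩≡∑ N (λ n → g n * h n) r≤N ⟩
    ∑ N (λ n → 𝟙 (fromℕ n ≟ r) * (g n * h n))    ≡⟨ ∑-cong N (λ n → trans (𝟙-guard (fromℕ n ≟ r) (λ n≡r → trans (cong (g n *_) (h≡c n n≡r)) (*-comm (g n) c)))
                                                        (solve 3 (λ i c g → i :* (c :* g) := c :* (i :* g)) refl (𝟙 (fromℕ n ≟ r)) c (g n))) ⟩
    ∑ N (λ n → c * (𝟙 (fromℕ n ≟ r) * g n))      ≡⟨ *-∑ c N (λ n → 𝟙 (fromℕ n ≟ r) * g n) ⟨
    c * ∑ N (λ n → 𝟙 (fromℕ n ≟ r) * g n)        ≡⟨ cong (c *_) (⟨⟩≡∑ N g r≤N) ⟨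
    c * g ⟨ r ⟩                                  ≡⟨ *-comm c (g ⟨ r ⟩) ⟩
    g ⟨ r ⟩ * c                                  ∎
    where
    N = proj₁ (archimedean r)
    r≤N = proj₂ (archimedean r)

  -- Double sums

  module _ (N : ℕ) (α β : ℕ → K) where
    -- A region of lattice points inside the square of side `N`. Since the square is common to all
    -- regions, identities between them can be checked point by point.
    ∑∑ : ∀ {P : ℕ → ℕ → Set} → (∀ m n → Dec (P m n)) → K
    ∑∑ P? = ∑ N λ m → ∑ N λ n → 𝟙 (P? m n) * (α m * β n)

    ∑∑-+ : ∀ {P Q : ℕ → ℕ → Set} (P? : ∀ m n → Dec (P m n)) (Q? : ∀ m n → Dec (Q m n)) →
           ∑∑ P? + ∑∑ Q? ≡ ∑ N λ m → ∑ N λ n → (𝟙 (P? m n) + 𝟙 (Q? m n)) * (α m * β n)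
    ∑∑-+ P? Q? = trans (sym (∑-+ N _ _)) (∑-cong N λ m →
      trans (sym (∑-+ N _ _)) (∑-cong N λ n → sym (distribʳ (α m * β n) (𝟙 (P? m n)) (𝟙 (Q? m n)))))

    ∑∑-+-cong : ∀ {P Q P′ Q′ : ℕ → ℕ → Set} (P? : ∀ m n → Dec (P m n)) (Q? : ∀ m n → Dec (Q m n))
                (P′? : ∀ m n → Dec (P′ m n)) (Q′? : ∀ m n → Dec (Q′ m n)) →
                (∀ m n .⦃ _ : NonZero m ⦄ .⦃ _ : NonZero n ⦄ → 𝟙 (P? m n) + 𝟙 (Q? m n) ≡ 𝟙 (P′? m n) + 𝟙 (Q′? m n)) →
                ∑∑ P? + ∑∑ Q? ≡ ∑∑ P′? + ∑∑ Q′?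
    ∑∑-+-cong P? Q? P′? Q′? eq = begin
      ∑∑ P? + ∑∑ Q?                                                      ≡⟨ ∑∑-+ P? Q? ⟩
      (∑ N λ m → ∑ N λ n → (𝟙 (P? m n) + 𝟙 (Q? m n)) * (α m * β n))      ≡⟨ ∑-cong N (λ m → ∑-cong N λ n → cong (_* (α m * β n)) (eq m n)) ⟩
      (∑ N λ m → ∑ N λ n → (𝟙 (P′? m n) + 𝟙 (Q′? m n)) * (α m * β n))    ≡⟨ ∑∑-+ P′? Q′? ⟨
      ∑∑ P′? + ∑∑ Q′?                                                    ∎

    -- The inner sum `F m` may depend on `m` through its length. Its expansion is required only for
    -- `m` within `x`, because in the split of the rectangle the inner length stays below `N` only
    -- there.
    ∑≤-expand : ∀ {x} {Q : ℕ → ℕ → Set} (Q? : ∀ m n → Dec (Q m n)) {F : ℕ → K} → x ≤ fromℕ N →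
                (∀ m .⦃ _ : NonZero m ⦄ → fromℕ m ≤ x → F m ≡ ∑ N (λ n → 𝟙 (Q? m n) * β n)) →
                ∑≤ x (λ m → α m * F m) ≡ ∑∑ (λ m n → (fromℕ m ≤? x) ×-dec Q? m n)
    ∑≤-expand {x} Q? {F} x≤N F≡ = trans (∑≤≡∑ N (λ m → α m * F m) x≤N) (∑-cong N λ m →
        let p = fromℕ m ≤? x in begin
      𝟙 p * (α m * F m)                                   ≡⟨ 𝟙-guard p (λ m≤x → cong (α m *_) (F≡ m m≤x)) ⟩
      𝟙 p * (α m * ∑ N (λ n → 𝟙 (Q? m n) * β n))          ≡⟨ *-assoc (𝟙 p) (α m) _ ⟨
      (𝟙 p * α m) * ∑ N (λ n → 𝟙 (Q? m n) * β n)          ≡⟨ *-∑ (𝟙 p * α m) N (λ n → 𝟙 (Q? m n) * β n) ⟩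
      ∑ N (λ n → (𝟙 p * α m) * (𝟙 (Q? m n) * β n))        ≡⟨ ∑-cong N (λ n → trans
          (solve 4 (λ p a q b → (p :* a) :* (q :* b) := (p :* q) :* (a :* b)) refl (𝟙 p) (α m) (𝟙 (Q? m n)) (β n))
          (cong (_* (α m * β n)) (sym (𝟙-× p (Q? m n))))) ⟩
      ∑ N (λ n → 𝟙 (p ×-dec Q? m n) * (α m * β n))        ∎)

    ∑≤-*-∑≤ : ∀ {x y} → x ≤ fromℕ N → y ≤ fromℕ N →
              ∑≤ x α * ∑≤ y β ≡ ∑∑ (λ m n → (fromℕ m ≤? x) ×-dec (fromℕ n ≤? y))
    ∑≤-*-∑≤ {x} {y} x≤N y≤N = trans (sym (∑≤-* x α (∑≤ y β)))
      (∑≤-expand (λ _ n → fromℕ n ≤? y) x≤N (λ _ _ → ∑≤≡∑ N β y≤N))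

    -- Factors of a positive `n` are at most `n`, so enlarging the square of side `n` to side `N`
    -- adds no pair.
    ⋆≡∑∑ : ∀ {n} → n ℕ.≤ N → .⦃ _ : NonZero n ⦄ → (α ⋆ β) n ≡ ∑∑ (λ u v → u ℕ.* v ℕₚ.≟ n)
    ⋆≡∑∑ {n} n≤N = begin
      (α ⋆ β) n
        ≡⟨ ∑∈-filter (λ (u , v) → u ℕ.* v ℕₚ.≟ n) (cartesianProduct (applyUpTo suc n) (applyUpTo suc n)) (λ (u , v) → α u * β v) ⟩
      ∑∈ (cartesianProduct (applyUpTo suc n) (applyUpTo suc n)) (λ (u , v) → 𝟙 (u ℕ.* v ℕₚ.≟ n) * (α u * β v))
        ≡⟨ ∑∈-cartesianProduct (applyUpTo suc n) (applyUpTo suc n) (λ (u , v) → 𝟙 (u ℕ.* v ℕₚ.≟ n) * (α u * β v)) ⟩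
      (∑ n λ u → ∑ n λ v → 𝟙 (u ℕ.* v ℕₚ.≟ n) * (α u * β v))
        ≡⟨ ∑-cong n (λ u → ∑-extend _ n≤N λ v n<v → 𝟙-no (u ℕ.* v ℕₚ.≟ n) _ (too-largeʳ u v n<v)) ⟩
      (∑ n λ u → ∑ N λ v → 𝟙 (u ℕ.* v ℕₚ.≟ n) * (α u * β v))
        ≡⟨ ∑-extend _ n≤N (λ u n<u → ∑-zero N λ v _ → 𝟙-no (u ℕ.* v ℕₚ.≟ n) _ (too-largeˡ u v n<u)) ⟩
      ∑∑ (λ u v → u ℕ.* v ℕₚ.≟ n)
        ∎
      where
      too-largeʳ : ∀ u v .⦃ _ : NonZero u ⦄ → n ℕ.< v → u ℕ.* v ≢ n
      too-largeʳ u v n<v refl = ℕₚ.<⇒≱ n<v (ℕₚ.m≤n*m v u)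
      too-largeˡ : ∀ u v .⦃ _ : NonZero v ⦄ → n ℕ.< u → u ℕ.* v ≢ n
      too-largeˡ u v n<u refl = ℕₚ.<⇒≱ n<u (ℕₚ.m≤m*n u v)

    -- Each pair `(u , v)` belongs to the single value `n = u v`. Moving the sum over `n` innermost
    -- lets it collapse to one term.
    ∑≤-⋆ : ∀ {z} → z ≤ fromℕ N → ∑≤ z (α ⋆ β) ≡ ∑∑ (λ u v → fromℕ (u ℕ.* v) ≤? z)
    ∑≤-⋆ {z} z≤N = begin
      ∑≤ z (α ⋆ β)
        ≡⟨ ∑≤≡∑ N (α ⋆ β) z≤N ⟩
      ∑ N (λ n → 𝟙 (fromℕ n ≤? z) * (α ⋆ β) n)
        ≡⟨ ∑-cong′ N (λ n n≤N → trans (cong (𝟙 (fromℕ n ≤? z) *_) (⋆≡∑∑ n≤N)) (*-∑ (𝟙 (fromℕ n ≤? z)) N _)) ⟩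
      (∑ N λ n → ∑ N λ u → 𝟙 (fromℕ n ≤? z) * ∑ N λ v → 𝟙 (u ℕ.* v ℕₚ.≟ n) * (α u * β v))
        ≡⟨ ∑-comm N N _ ⟩
      (∑ N λ u → ∑ N λ n → 𝟙 (fromℕ n ≤? z) * ∑ N λ v → 𝟙 (u ℕ.* v ℕₚ.≟ n) * (α u * β v))
        ≡⟨ ∑-cong N (λ u → ∑-cong N λ n → *-∑ (𝟙 (fromℕ n ≤? z)) N _) ⟩
      (∑ N λ u → ∑ N λ n → ∑ N λ v → 𝟙 (fromℕ n ≤? z) * (𝟙 (u ℕ.* v ℕₚ.≟ n) * (α u * β v)))
        ≡⟨ ∑-cong N (λ u → ∑-comm N N _) ⟩
      (∑ N λ u → ∑ N λ v → ∑ N λ n → 𝟙 (fromℕ n ≤? z) * (𝟙 (u ℕ.* v ℕₚ.≟ n) * (α u * β v)))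
        ≡⟨ ∑-cong N (λ u → ∑-cong N λ v → trans (∑-cong N λ n → rearrange (𝟙 (fromℕ n ≤? z)) (𝟙 (u ℕ.* v ℕₚ.≟ n)) (α u * β v)) (collapse u v)) ⟩
      ∑∑ (λ u v → fromℕ (u ℕ.* v) ≤? z)
        ∎
      where
      rearrange : ∀ i j c → i * (j * c) ≡ j * (i * c)
      rearrange = solve 3 (λ i j c → i :* (j :* c) := j :* (i :* c)) refl
      collapse : ∀ u v .⦃ _ : NonZero u ⦄ .⦃ _ : NonZero v ⦄ →
                 ∑ N (λ n → 𝟙 (u ℕ.* v ℕₚ.≟ n) * (𝟙 (fromℕ n ≤? z) * (α u * β v))) ≡ 𝟙 (fromℕ (u ℕ.* v) ≤? z) * (α u * β v)
      collapse u v with u ℕ.* v ℕₚ.≤? N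
      ... | yes uv≤N = ∑-δ N (λ n → 𝟙 (fromℕ n ≤? z) * (α u * β v)) (u ℕ.* v) ⦃ ℕₚ.m*n≢0 u v ⦄ uv≤N
      -- The product may lie outside the range of `n`. Then no `n` matches it, and since it exceeds
      -- `N`, hence `z`, the indicator on the right vanishes as well.
      ... | no uv≰N  = trans
        (∑-zero N λ n n≤N → 𝟙-no (u ℕ.* v ℕₚ.≟ n) _ λ { refl → uv≰N n≤N })
        (sym (𝟙-no (fromℕ (u ℕ.* v) ≤? z) _ (beyond z≤N (u ℕ.* v) (ℕₚ.≰⇒> uv≰N))))

  ∑∑-swap : ∀ N α β {P : ℕ → ℕ → Set} (P? : ∀ m n → Dec (P m n)) → ∑∑ N β α P? ≡ ∑∑ N α β (λ m n → P? n m)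
  ∑∑-swap N α β P? = trans (∑-comm N N _) (∑-cong N λ m → ∑-cong N λ n → cong (𝟙 (P? n m) *_) (*-comm (β n) (α m)))

  -- The two lattice point identities: hyperbola and rectangle.

  module _ (x y : ℝ) (α β : ℕ → K) where
    private
      n₁ = proj₁ (archimedean x)
      n₂ = proj₁ (archimedean y)
      n₃ = proj₁ (archimedean (x *ᴿ y))
      N = n₁ ℕ.+ n₂ ℕ.+ n₃

      x≤N : x ≤ fromℕ N
      x≤N = ℝₚ.≤-trans (proj₂ (archimedean x))
        (ℝₚ.fromℕ-mono-≤ (ℕₚ.≤-trans (ℕₚ.m≤m+n n₁ n₂) (ℕₚ.m≤m+n (n₁ ℕ.+ n₂) n₃)))

      y≤N : y ≤ fromℕ N
      y≤N = ℝₚ.≤-trans (proj₂ (archimedean y))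
        (ℝₚ.fromℕ-mono-≤ (ℕₚ.≤-trans (ℕₚ.m≤n+m n₂ n₁) (ℕₚ.m≤m+n (n₁ ℕ.+ n₂) n₃)))

      xy≤N : x *ᴿ y ≤ fromℕ N
      xy≤N = ℝₚ.≤-trans (proj₂ (archimedean (x *ᴿ y))) (ℝₚ.fromℕ-mono-≤ (ℕₚ.m≤n+m n₃ (n₁ ℕ.+ n₂)))

    -- If `u v` is at most `x y`, then `u` is at most `x` or `v` is at most `y`, so the two regions
    -- on the left cover everything under the hyperbola. The rectangle lies under the hyperbola, so
    -- it is exactly their intersection.
    hyperbola : 0ᴿ ≤ x → 0ᴿ ≤ y →
      ∑≤ x (λ u → α u * ∑≤ ((x *ᴿ y) / fromℕ u) β) + ∑≤ y (λ v → β v * ∑≤ ((x *ᴿ y) / fromℕ v) α)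
        ≡ ∑≤ (x *ᴿ y) (α ⋆ β) + ∑≤ x α * ∑≤ y β
    hyperbola 0≤x 0≤y = begin
      ∑≤ x (λ u → α u * ∑≤ (z / fromℕ u) β) + ∑≤ y (λ v → β v * ∑≤ (z / fromℕ v) α)
        ≡⟨ cong₂ _+_ (∑≤-expand N α β (λ u v → fromℕ v ≤? z / fromℕ u) x≤N (λ u _ → ∑≤≡∑ N β (quotient≤N u)))
                     (trans (∑≤-expand N β α (λ v u → fromℕ u ≤? z / fromℕ v) y≤N (λ v _ → ∑≤≡∑ N α (quotient≤N v)))
                            (∑∑-swap N α β (λ v u → Q? u v))) ⟩
      ∑∑ N α β P? + ∑∑ N α β Q?
        ≡⟨ ∑∑-+-cong N α β P? Q? P′? Q′? (λ u v → 𝟙-+-cong (P? u v) (Q? u v) (P′? u v) (Q′? u v)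
             (forth u v) (back u v)
             (λ ((u≤x , v≤z/u) , (v≤y , _)) → product≤ u v v≤z/u , (u≤x , v≤y))
             (λ (uv≤z , (u≤x , v≤y)) → (u≤x , ≤quotientʳ u v uv≤z) , (v≤y , ≤quotientˡ u v uv≤z))) ⟩
      ∑∑ N α β P′? + ∑∑ N α β Q′?
        ≡⟨ cong₂ _+_ (∑≤-⋆ N α β xy≤N) (∑≤-*-∑≤ N α β x≤N y≤N) ⟨
      ∑≤ z (α ⋆ β) + ∑≤ x α * ∑≤ y β ∎
      where
      z = x *ᴿ y

      P? : ∀ u v → Dec (fromℕ u ≤ x × fromℕ v ≤ z / fromℕ u)
      P? u v = (fromℕ u ≤? x) ×-dec (fromℕ v ≤? z / fromℕ u)

      Q? : ∀ u v → Dec (fromℕ v ≤ y × fromℕ u ≤ z / fromℕ v)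
      Q? u v = (fromℕ v ≤? y) ×-dec (fromℕ u ≤? z / fromℕ v)

      P′? : ∀ u v → Dec (fromℕ (u ℕ.* v) ≤ z)
      P′? u v = fromℕ (u ℕ.* v) ≤? z

      Q′? : ∀ u v → Dec (fromℕ u ≤ x × fromℕ v ≤ y)
      Q′? u v = (fromℕ u ≤? x) ×-dec (fromℕ v ≤? y)

      quotient≤N : ∀ n .⦃ _ : NonZero n ⦄ → z / fromℕ n ≤ fromℕ N
      quotient≤N n = ℝₚ.≤-trans z/n≤z xy≤N
        where
        0≤z/n : 0ᴿ ≤ z / fromℕ n
        0≤z/n = ℝₚ./-nonNegative (R.*-nonNegative 0≤x 0≤y) (ℝₚ.fromℕ-positive n)
        z/n≤z : z / fromℕ n ≤ z
        z/n≤z = subst₂ _≤_ (ℝₚ.*-identityʳ _) (ℝₚ./-*-cancel z (ℝₚ.fromℕ-positive n)) (ℝₚ.*-monoˡ-≤ 0≤z/n (ℝₚ.1≤fromℕ n))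

      product≤ : ∀ u v .⦃ _ : NonZero u ⦄ → fromℕ v ≤ z / fromℕ u → fromℕ (u ℕ.* v) ≤ z
      product≤ u v v≤z/u = subst (_≤ z) (trans (ℝₚ.*-comm (fromℕ v) (fromℕ u)) (sym (ℝₚ.fromℕ-* u v))) (ℝₚ.≤/⇒*≤ (ℝₚ.fromℕ-positive u) v≤z/u)

      ≤quotientʳ : ∀ u v .⦃ _ : NonZero u ⦄ → fromℕ (u ℕ.* v) ≤ z → fromℕ v ≤ z / fromℕ u
      ≤quotientʳ u v uv≤z = ℝₚ.*≤⇒≤/ (ℝₚ.fromℕ-positive u) (subst (_≤ z) (trans (ℝₚ.fromℕ-* u v) (ℝₚ.*-comm (fromℕ u) (fromℕ v))) uv≤z)

      ≤quotientˡ : ∀ u v .⦃ _ : NonZero v ⦄ → fromℕ (u ℕ.* v) ≤ z → fromℕ u ≤ z / fromℕ v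
      ≤quotientˡ u v uv≤z = ℝₚ.*≤⇒≤/ (ℝₚ.fromℕ-positive v) (subst (_≤ z) (ℝₚ.fromℕ-* u v) uv≤z)

      forth : ∀ u v .⦃ _ : NonZero u ⦄ .⦃ _ : NonZero v ⦄ →
              (fromℕ u ≤ x × fromℕ v ≤ z / fromℕ u) ⊎ (fromℕ v ≤ y × fromℕ u ≤ z / fromℕ v) →
              fromℕ (u ℕ.* v) ≤ z ⊎ (fromℕ u ≤ x × fromℕ v ≤ y)
      forth u v (inj₁ (_ , v≤z/u)) = inj₁ (product≤ u v v≤z/u)
      forth u v (inj₂ (_ , u≤z/v)) = inj₁ (subst (_≤ z) (sym (ℝₚ.fromℕ-* u v)) (ℝₚ.≤/⇒*≤ (ℝₚ.fromℕ-positive v) u≤z/v))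

      back : ∀ u v .⦃ _ : NonZero u ⦄ .⦃ _ : NonZero v ⦄ →
             fromℕ (u ℕ.* v) ≤ z ⊎ (fromℕ u ≤ x × fromℕ v ≤ y) →
             (fromℕ u ≤ x × fromℕ v ≤ z / fromℕ u) ⊎ (fromℕ v ≤ y × fromℕ u ≤ z / fromℕ v)
      back u v (inj₂ (u≤x , v≤y)) = inj₁ (u≤x , ≤quotientʳ u v
        (subst (_≤ z) (sym (ℝₚ.fromℕ-* u v)) (ℝₚ.*-mono-≤ (ℝₚ.fromℕ-nonNegative v) 0≤x u≤x v≤y)))
      back u v (inj₁ uv≤z) with fromℕ u ≤? x | fromℕ v ≤? y
      ... | yes u≤x | _       = inj₁ (u≤x , ≤quotientʳ u v uv≤z)
      ... | no _    | yes v≤y = inj₂ (v≤y , ≤quotientˡ u v uv≤z)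
      ... | no u≰x  | no v≰y  = ⊥-elim (ℝₚ.<⇒≱ (ℝₚ.*-mono-< 0≤x 0≤y (ℝₚ.≰⇒> u≰x) (ℝₚ.≰⇒> v≰y)) (subst (_≤ z) (ℝₚ.fromℕ-* u v) uv≤z))

    -- The pairs with m ≤ x and n ≤ y are split by the line y m = x n, which
    -- both parts contain; the pairs on it give the last sum.
    split-rectangle : 0ᴿ < x → 0ᴿ ≤ y →
      ∑≤ x (λ m → α m * ∑≤ ((y *ᴿ fromℕ m) / x) β) + ∑≤ y (λ n → β n * ∑≤ ((fromℕ n *ᴿ x) / y) α)
        ≡ ∑≤ x α * ∑≤ y β + ∑≤ y (λ n → β n * α ⟨ (x / y) *ᴿ fromℕ n ⟩)
    split-rectangle 0<x 0≤y = begin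
      ∑≤ x (λ m → α m * ∑≤ ((y *ᴿ fromℕ m) / x) β) + ∑≤ y (λ n → β n * ∑≤ ((fromℕ n *ᴿ x) / y) α)
        ≡⟨ cong₂ _+_ (∑≤-expand N α β (λ m n → fromℕ n ≤? (y *ᴿ fromℕ m) / x) x≤N (λ m m≤x → ∑≤≡∑ N β (ℝₚ.≤-trans (ym/x≤y m m≤x) y≤N)))
                     (trans (∑≤-expand N β α (λ n m → fromℕ m ≤? (fromℕ n *ᴿ x) / y) y≤N (λ n n≤y → ∑≤≡∑ N α (ℝₚ.≤-trans (nx/y≤x n n≤y) x≤N)))
                            (∑∑-swap N α β (λ n m → Q? m n))) ⟩
      ∑∑ N α β P? + ∑∑ N α β Q?
        ≡⟨ ∑∑-+-cong N α β P? Q? P′? Q′? (λ m n → 𝟙-+-cong (P? m n) (Q? m n) (P′? m n) (Q′? m n)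
             (forth m n) (back m n) (on-line m n) (off-line m n)) ⟩
      ∑∑ N α β P′? + ∑∑ N α β Q′?
        ≡⟨ cong₂ _+_ (∑≤-*-∑≤ N α β x≤N y≤N)
                     (trans (∑≤-expand N β α (λ n m → fromℕ m ≟ (x / y) *ᴿ fromℕ n) y≤N
                              (λ n n≤y → ⟨⟩≡∑ N α (ℝₚ.≤-trans (subst (_≤ x) (nx/y≡ n) (nx/y≤x n n≤y)) x≤N)))
                            (∑∑-swap N α β (λ n m → Q′? m n))) ⟨
      ∑≤ x α * ∑≤ y β + ∑≤ y (λ n → β n * α ⟨ (x / y) *ᴿ fromℕ n ⟩) ∎
      where
      -- Since `Q′` implies `P′`, the pair on the right has the rectangle as union and the line as
      -- intersection. For `P` and `Q` the union is the rectangle by totality of the order on `n x`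
      -- and `m y`, and the intersection is the line by antisymmetry.
      P Q P′ Q′ : ℕ → ℕ → Set
      P  m n = fromℕ m ≤ x × fromℕ n ≤ (y *ᴿ fromℕ m) / x
      Q  m n = fromℕ n ≤ y × fromℕ m ≤ (fromℕ n *ᴿ x) / y
      P′ m n = fromℕ m ≤ x × fromℕ n ≤ y
      Q′ m n = fromℕ n ≤ y × fromℕ m ≡ (x / y) *ᴿ fromℕ n

      P? : ∀ m n → Dec (P m n)
      P? m n = (fromℕ m ≤? x) ×-dec (fromℕ n ≤? (y *ᴿ fromℕ m) / x)

      Q? : ∀ m n → Dec (Q m n)
      Q? m n = (fromℕ n ≤? y) ×-dec (fromℕ m ≤? (fromℕ n *ᴿ x) / y)

      P′? : ∀ m n → Dec (P′ m n)
      P′? m n = (fromℕ m ≤? x) ×-dec (fromℕ n ≤? y)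

      Q′? : ∀ m n → Dec (Q′ m n)
      Q′? m n = (fromℕ n ≤? y) ×-dec (fromℕ m ≟ (x / y) *ᴿ fromℕ n)

      -- Here `y` may be zero. Division by it is meaningful because it happens only next to some
      -- positive integer `n` with `n ≤ y`.
      0<y : ∀ n .⦃ _ : NonZero n ⦄ → fromℕ n ≤ y → 0ᴿ < y
      0<y n n≤y = ℝₚ.<-≤-trans (ℝₚ.fromℕ-positive n) n≤y

      nx/y≡ : ∀ n → (fromℕ n *ᴿ x) / y ≡ (x / y) *ᴿ fromℕ n
      nx/y≡ n = trans (ℝₚ.*-assoc _ _ _) (ℝₚ.*-comm _ _)

      ym/x≤y : ∀ m → fromℕ m ≤ x → (y *ᴿ fromℕ m) / x ≤ y
      ym/x≤y m m≤x = ℝₚ.*-cancelʳ-≤ 0<x (subst (_≤ y *ᴿ x) (sym (ℝₚ./-*-cancel _ 0<x)) (ℝₚ.*-monoˡ-≤ 0≤y m≤x))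

      nx/y≤x : ∀ n .⦃ _ : NonZero n ⦄ → fromℕ n ≤ y → (fromℕ n *ᴿ x) / y ≤ x
      nx/y≤x n n≤y = ℝₚ.*-cancelʳ-≤ (0<y n n≤y)
        (subst₂ _≤_ (sym (ℝₚ./-*-cancel _ (0<y n n≤y))) (ℝₚ.*-comm y x) (ℝₚ.*-monoʳ-≤ (proj₁ 0<x) n≤y))

      module _ (m n : ℕ) .⦃ _ : NonZero m ⦄ .⦃ _ : NonZero n ⦄ where
        below : fromℕ n ≤ (y *ᴿ fromℕ m) / x → fromℕ n *ᴿ x ≤ fromℕ m *ᴿ y
        below n≤ym/x = subst (fromℕ n *ᴿ x ≤_) (ℝₚ.*-comm y (fromℕ m)) (ℝₚ.≤/⇒*≤ 0<x n≤ym/x)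

        below⁻¹ : fromℕ n *ᴿ x ≤ fromℕ m *ᴿ y → fromℕ n ≤ (y *ᴿ fromℕ m) / x
        below⁻¹ nx≤my = ℝₚ.*≤⇒≤/ 0<x (subst (fromℕ n *ᴿ x ≤_) (ℝₚ.*-comm (fromℕ m) y) nx≤my)

        on-line⇒P×Q : Q′ m n → P m n × Q m n
        on-line⇒P×Q (n≤y , m≡) =
          (subst (_≤ x) m≡′ (nx/y≤x n n≤y) , below⁻¹ (ℝₚ.≤-reflexive (trans (sym (ℝₚ./-*-cancel _ (0<y n n≤y))) (cong (_*ᴿ y) m≡′)))) ,
          (n≤y , ℝₚ.≤-reflexive (sym m≡′))
          where
          m≡′ : (fromℕ n *ᴿ x) / y ≡ fromℕ m
          m≡′ = trans (nx/y≡ n) (sym m≡)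

        forth : P m n ⊎ Q m n → P′ m n ⊎ Q′ m n
        forth (inj₁ (m≤x , n≤ym/x)) = inj₁ (m≤x , ℝₚ.≤-trans n≤ym/x (ym/x≤y m m≤x))
        forth (inj₂ (n≤y , m≤nx/y)) = inj₁ (ℝₚ.≤-trans m≤nx/y (nx/y≤x n n≤y) , n≤y)

        back : P′ m n ⊎ Q′ m n → P m n ⊎ Q m n
        back (inj₂ q′) = inj₁ (proj₁ (on-line⇒P×Q q′))
        back (inj₁ (m≤x , n≤y)) with ℝₚ.≤-total (fromℕ n *ᴿ x) (fromℕ m *ᴿ y)
        ... | inj₁ nx≤my = inj₁ (m≤x , below⁻¹ nx≤my)
        ... | inj₂ my≤nx = inj₂ (n≤y , ℝₚ.*≤⇒≤/ (0<y n n≤y) my≤nx)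

        on-line : P m n × Q m n → P′ m n × Q′ m n
        on-line ((m≤x , n≤ym/x) , (n≤y , m≤nx/y)) = (m≤x , n≤y) , (n≤y , trans m≡nx/y (nx/y≡ n))
          where
          m≡nx/y : fromℕ m ≡ (fromℕ n *ᴿ x) / y
          m≡nx/y = ℝₚ.≤-antisym m≤nx/y (ℝₚ.*-cancelʳ-≤ (0<y n n≤y)
            (subst (_≤ fromℕ m *ᴿ y) (sym (ℝₚ./-*-cancel _ (0<y n n≤y))) (below n≤ym/x)))

        off-line : P′ m n × Q′ m n → P m n × Q m n
        off-line (_ , q′) = on-line⇒P×Q q′

  -- The product of two relations with abstract coefficients.

  -- The value `f` is the same for every `n`, so each term of the sum may expand it by a different
  -- instance of the relation; `p n`, `q n` and `e n` belong to the instance chosen for `n`.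
  ∑≤-relation : ∀ x (α p q e : ℕ → K) (f ψ : K) →
    (∀ n .⦃ _ : NonZero n ⦄ → fromℕ n ≤ x → f ≡ p n + ψ * q n + e n) →
    ∑≤ x α * f ≡ ∑≤ x (λ n → α n * p n) + ψ * ∑≤ x (λ n → α n * q n) + ∑≤ x (λ n → α n * e n)
  ∑≤-relation x α p q e f ψ f≡ = begin
    ∑≤ x α * f
      ≡⟨ ∑≤-* x α f ⟨
    ∑≤ x (λ n → α n * f)
      ≡⟨ ∑≤-cong x (λ n n≤x → trans (cong (α n *_) (f≡ n n≤x)) (expand (α n) (p n) ψ (q n) (e n))) ⟩
    ∑≤ x (λ n → α n * p n + ψ * (α n * q n) + α n * e n)
      ≡⟨ trans (∑≤-+ x _ _) (cong (_+ ∑≤ x (λ n → α n * e n)) (∑≤-+ x _ _)) ⟩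
    ∑≤ x (λ n → α n * p n) + ∑≤ x (λ n → ψ * (α n * q n)) + ∑≤ x (λ n → α n * e n)
      ≡⟨ cong (λ z → ∑≤ x (λ n → α n * p n) + z + ∑≤ x (λ n → α n * e n)) (*-∑≤ ψ x (λ n → α n * q n)) ⟨
    ∑≤ x (λ n → α n * p n) + ψ * ∑≤ x (λ n → α n * q n) + ∑≤ x (λ n → α n * e n) ∎
    where
    expand : ∀ a p ψ q e → a * (p + ψ * q + e) ≡ a * p + ψ * (a * q) + a * e
    expand = solve 5 (λ a p ψ q e → a :* (p :+ ψ :* q :+ e) := a :* p :+ ψ :* (a :* q) :+ a :* e) refl

  -- Write Mᵢ for the main part Pᵢ + ψᵢQᵢ. Then M₁f₂ + M₂f₁ + E₁E₂ = f₁f₂ + M₁M₂, and `Z` is M₁M₂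
  -- expanded. The lattice point identities produce the same M₁M₂ next to the wanted terms: `H`
  -- stands for the a·a sums, `G` for the b·b sums, `K` for the mixed ones. Adding `Z` to both sides
  -- and cancelling it avoids subtraction, so that the remaining identities are semiring identities
  -- for the solver.
  combine : ∀ P₁ P₂ Q₁ Q₂ ψ₁ ψ₂ E₁ E₂ {f₁ f₂ SA SB H₁ H₂ G₁ G₂ K₁ K₂ K₃ K₄ M₁ M₂ I₁ I₂ J₃ J₄} →
    f₁ ≡ P₁ + ψ₁ * Q₁ + E₁ → f₂ ≡ P₂ + ψ₂ * Q₂ + E₂ →
    P₁ * f₂ ≡ H₁ + ψ₂ * K₁ + I₁ → P₂ * f₁ ≡ H₂ + ψ₁ * K₂ + I₂ →
    Q₁ * f₂ ≡ K₃ + ψ₂ * G₁ + J₃ → Q₂ * f₁ ≡ K₄ + ψ₁ * G₂ + J₄ →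
    H₁ + H₂ ≡ SA + P₁ * P₂ → G₁ + G₂ ≡ SB + Q₁ * Q₂ →
    K₁ + K₄ ≡ P₁ * Q₂ + M₂ → K₂ + K₃ ≡ P₂ * Q₁ + M₁ →
    f₁ * f₂ ≡ SA + ψ₁ * ψ₂ * SB + (I₁ + I₂ + ψ₁ * J₃ + ψ₂ * J₄ + E₁ * E₂ + ψ₁ * M₁ + ψ₂ * M₂)
  combine P₁ P₂ Q₁ Q₂ ψ₁ ψ₂ E₁ E₂ {f₁} {f₂} {SA} {SB}
          {H₁} {H₂} {G₁} {G₂} {K₁} {K₂} {K₃} {K₄} {M₁} {M₂} {I₁} {I₂} {J₃} {J₄} f₁≡ f₂≡ r₁ r₂ r₃ r₄ h g k₂ k₁ =
    +-cancelʳ Z (f₁ * f₂) _ (sym (begin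
      SA + ψ₁ * ψ₂ * SB + (I₁ + I₂ + ψ₁ * J₃ + ψ₂ * J₄ + E₁ * E₂ + ψ₁ * M₁ + ψ₂ * M₂) + Z
        ≡⟨ solve 16 (λ SA SB I₁ I₂ J₃ J₄ W M₁ M₂ PP PQ QP QQ ψ₁ ψ₂ ψψ →
             SA :+ ψψ :* SB :+ (I₁ :+ I₂ :+ ψ₁ :* J₃ :+ ψ₂ :* J₄ :+ W :+ ψ₁ :* M₁ :+ ψ₂ :* M₂)
               :+ (PP :+ ψψ :* QQ :+ ψ₂ :* PQ :+ ψ₁ :* QP)
             := (SA :+ PP) :+ ψψ :* (SB :+ QQ) :+ ψ₂ :* (PQ :+ M₂) :+ ψ₁ :* (QP :+ M₁) :+ (I₁ :+ I₂ :+ ψ₁ :* J₃ :+ ψ₂ :* J₄ :+ W))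
             refl SA SB I₁ I₂ J₃ J₄ (E₁ * E₂) M₁ M₂
             (P₁ * P₂) (P₁ * Q₂) (P₂ * Q₁) (Q₁ * Q₂) ψ₁ ψ₂ (ψ₁ * ψ₂) ⟩
      (SA + P₁ * P₂) + ψ₁ * ψ₂ * (SB + Q₁ * Q₂) + ψ₂ * (P₁ * Q₂ + M₂) + ψ₁ * (P₂ * Q₁ + M₁) + (I₁ + I₂ + ψ₁ * J₃ + ψ₂ * J₄ + E₁ * E₂)
        ≡⟨ cong (_+ (I₁ + I₂ + ψ₁ * J₃ + ψ₂ * J₄ + E₁ * E₂)) (cong₂ _+_ (cong₂ _+_ (cong₂ _+_ h (cong (ψ₁ * ψ₂ *_) g)) (cong (ψ₂ *_) k₂)) (cong (ψ₁ *_) k₁)) ⟨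
      (H₁ + H₂) + ψ₁ * ψ₂ * (G₁ + G₂) + ψ₂ * (K₁ + K₄) + ψ₁ * (K₂ + K₃) + (I₁ + I₂ + ψ₁ * J₃ + ψ₂ * J₄ + E₁ * E₂)
        ≡⟨ solve 15 (λ H₁ H₂ G₁ G₂ K₁ K₂ K₃ K₄ I₁ I₂ J₃ J₄ W ψ₁ ψ₂ →
             (H₁ :+ H₂) :+ ψ₁ :* ψ₂ :* (G₁ :+ G₂) :+ ψ₂ :* (K₁ :+ K₄) :+ ψ₁ :* (K₂ :+ K₃) :+ (I₁ :+ I₂ :+ ψ₁ :* J₃ :+ ψ₂ :* J₄ :+ W)
             := (H₁ :+ ψ₂ :* K₁ :+ I₁) :+ (H₂ :+ ψ₁ :* K₂ :+ I₂) :+ ψ₁ :* (K₃ :+ ψ₂ :* G₁ :+ J₃) :+ ψ₂ :* (K₄ :+ ψ₁ :* G₂ :+ J₄) :+ W)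
             refl H₁ H₂ G₁ G₂ K₁ K₂ K₃ K₄ I₁ I₂ J₃ J₄ (E₁ * E₂) ψ₁ ψ₂ ⟩
      (H₁ + ψ₂ * K₁ + I₁) + (H₂ + ψ₁ * K₂ + I₂) + ψ₁ * (K₃ + ψ₂ * G₁ + J₃) + ψ₂ * (K₄ + ψ₁ * G₂ + J₄) + E₁ * E₂
        ≡⟨ cong (_+ E₁ * E₂) (cong₂ _+_ (cong₂ _+_ (cong₂ _+_ r₁ r₂) (cong (ψ₁ *_) r₃)) (cong (ψ₂ *_) r₄)) ⟨
      P₁ * f₂ + P₂ * f₁ + ψ₁ * (Q₁ * f₂) + ψ₂ * (Q₂ * f₁) + E₁ * E₂
        ≡⟨ cong₂ (λ f₁ f₂ → P₁ * f₂ + P₂ * f₁ + ψ₁ * (Q₁ * f₂) + ψ₂ * (Q₂ * f₁) + E₁ * E₂) f₁≡ f₂≡ ⟩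
      P₁ * F₂ + P₂ * F₁ + ψ₁ * (Q₁ * F₂) + ψ₂ * (Q₂ * F₁) + E₁ * E₂
        ≡⟨ solve 8 (λ P₁ P₂ Q₁ Q₂ ψ₁ ψ₂ E₁ E₂ →
             let F₁ = P₁ :+ ψ₁ :* Q₁ :+ E₁
                 F₂ = P₂ :+ ψ₂ :* Q₂ :+ E₂ in
             P₁ :* F₂ :+ P₂ :* F₁ :+ ψ₁ :* (Q₁ :* F₂) :+ ψ₂ :* (Q₂ :* F₁) :+ E₁ :* E₂
             := F₁ :* F₂ :+ (P₁ :* P₂ :+ ψ₁ :* ψ₂ :* (Q₁ :* Q₂) :+ ψ₂ :* (P₁ :* Q₂) :+ ψ₁ :* (P₂ :* Q₁)))
             refl P₁ P₂ Q₁ Q₂ ψ₁ ψ₂ E₁ E₂ ⟩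
      F₁ * F₂ + Z
        ≡⟨ cong₂ (λ f₁ f₂ → f₁ * f₂ + Z) f₁≡ f₂≡ ⟨
      f₁ * f₂ + Z ∎))
    where
    F₁ = P₁ + ψ₁ * Q₁ + E₁
    F₂ = P₂ + ψ₂ * Q₂ + E₂
    Z = P₁ * P₂ + ψ₁ * ψ₂ * (Q₁ * Q₂) + ψ₂ * (P₁ * Q₂) + ψ₁ * (P₂ * Q₁)

  -- With the powers absorbed into the coefficients, the diagonal terms appear as plain values of
  -- `α₁` and `α₂`; the factors `ℓ ^ (- s)` of the statement are extracted only afterwards.
  product-relation : ∀ {f₁ f₂ ψ₁ ψ₂} (α₁ α₂ β₁ β₂ : ℕ → K) {T₁ T₂} (E₁ E₂ : ℝ → K) → 0ᴿ ≤ T₁ → 0ᴿ ≤ T₂ →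
    (∀ x → 0ᴿ < x → f₁ ≡ ∑≤ x α₁ + ψ₁ * ∑≤ (T₁ / x) β₁ + E₁ x) →
    (∀ x → 0ᴿ < x → f₂ ≡ ∑≤ x α₂ + ψ₂ * ∑≤ (T₂ / x) β₂ + E₂ x) →
    ∀ {x₁ x₂} → 0ᴿ < x₁ → 0ᴿ < x₂ →
    let y₁ = T₁ / x₁ ; y₂ = T₂ / x₂ in
    f₁ * f₂ ≡ ∑≤ (x₁ *ᴿ x₂) (α₁ ⋆ α₂) + ψ₁ * ψ₂ * ∑≤ (y₁ *ᴿ y₂) (β₁ ⋆ β₂)
      + ( ∑≤ x₁ (λ n → α₁ n * E₂ ((x₁ *ᴿ x₂) / fromℕ n)) + ∑≤ x₂ (λ n → α₂ n * E₁ ((x₁ *ᴿ x₂) / fromℕ n))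
        + ψ₁ * ∑≤ y₁ (λ m → β₁ m * E₂ ((fromℕ m *ᴿ x₂) / y₁)) + ψ₂ * ∑≤ y₂ (λ m → β₂ m * E₁ ((fromℕ m *ᴿ x₁) / y₂))
        + E₁ x₁ * E₂ x₂
        + ψ₁ * ∑≤ y₁ (λ m → β₁ m * α₂ ⟨ (x₂ / y₁) *ᴿ fromℕ m ⟩) + ψ₂ * ∑≤ y₂ (λ m → β₂ m * α₁ ⟨ (x₁ / y₂) *ᴿ fromℕ m ⟩))
  product-relation {f₁} {f₂} {ψ₁} {ψ₂} α₁ α₂ β₁ β₂ {T₁} {T₂} E₁ E₂ 0≤T₁ 0≤T₂ rel₁ rel₂ {x₁} {x₂} 0<x₁ 0<x₂ =
    combine (∑≤ x₁ α₁) (∑≤ x₂ α₂) (∑≤ y₁ β₁) (∑≤ y₂ β₂) ψ₁ ψ₂ (E₁ x₁) (E₂ x₂)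
      (rel₁ x₁ 0<x₁) (rel₂ x₂ 0<x₂)
      (∑≤-relation x₁ α₁ _ _ _ f₂ ψ₂ λ n _ → at rel₂ (0<x₁x₂/ n) (ℝₚ.dual-length T₂ 0<x₁ 0<x₂ (ℝₚ.fromℕ-positive n)))
      (∑≤-relation x₂ α₂ _ _ _ f₁ ψ₁ λ n _ → at rel₁ (0<x₁x₂/ n)
        (trans (cong (λ z → T₁ / (z / fromℕ n)) (ℝₚ.*-comm x₁ x₂)) (ℝₚ.dual-length T₁ 0<x₂ 0<x₁ (ℝₚ.fromℕ-positive n))))
      (∑≤-relation y₁ β₁ _ _ _ f₂ ψ₂ λ m m≤y₁ → at rel₂ (0<mx/ m 0<x₂ m≤y₁)
        (trans (ℝₚ.dual-length T₂ (ℝₚ.fromℕ-positive m) 0<x₂ (0<y m m≤y₁)) (cong (_/ fromℕ m) (ℝₚ.*-comm y₂ y₁))))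
      (∑≤-relation y₂ β₂ _ _ _ f₁ ψ₁ λ m m≤y₂ → at rel₁ (0<mx/ m 0<x₁ m≤y₂)
        (ℝₚ.dual-length T₁ (ℝₚ.fromℕ-positive m) 0<x₁ (0<y m m≤y₂)))
      (hyperbola x₁ x₂ α₁ α₂ (proj₁ 0<x₁) (proj₁ 0<x₂))
      (hyperbola y₁ y₂ β₁ β₂ (ℝₚ./-nonNegative 0≤T₁ 0<x₁) (ℝₚ./-nonNegative 0≤T₂ 0<x₂))
      -- The a₁·b₂ pairs arise twice, from f₂ expanded inside the sum of `α₁` and from f₁ expanded
      -- inside the sum of `β₂`; hence the mixed indices `x₁` and `y₂`.
      (split-rectangle x₁ y₂ α₁ β₂ 0<x₁ (ℝₚ./-nonNegative 0≤T₂ 0<x₂))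
      (split-rectangle x₂ y₁ α₂ β₁ 0<x₂ (ℝₚ./-nonNegative 0≤T₁ 0<x₁))
    where
    y₁ = T₁ / x₁
    y₂ = T₂ / x₂

    at : ∀ {f ψ T} {α β : ℕ → K} {E : ℝ → K} → (∀ x → 0ᴿ < x → f ≡ ∑≤ x α + ψ * ∑≤ (T / x) β + E x) →
         ∀ {x y} → 0ᴿ < x → T / x ≡ y → f ≡ ∑≤ x α + ψ * ∑≤ y β + E x
    at rel 0<x refl = rel _ 0<x

    0<y : ∀ m .⦃ _ : NonZero m ⦄ {y} → fromℕ m ≤ y → 0ᴿ < y
    0<y m m≤y = ℝₚ.<-≤-trans (ℝₚ.fromℕ-positive m) m≤y

    0<x₁x₂/ : ∀ n .⦃ _ : NonZero n ⦄ → 0ᴿ < (x₁ *ᴿ x₂) / fromℕ n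
    0<x₁x₂/ n = ℝₚ./-positive (ℝₚ.*-positive 0<x₁ 0<x₂) (ℝₚ.fromℕ-positive n)

    0<mx/ : ∀ m .⦃ _ : NonZero m ⦄ {x y} → 0ᴿ < x → fromℕ m ≤ y → 0ᴿ < (fromℕ m *ᴿ x) / y
    0<mx/ m 0<x m≤y = ℝₚ./-positive (ℝₚ.*-positive (ℝₚ.fromℕ-positive m) 0<x) (0<y m m≤y)

  -- Separating multiplicative weights from coefficients, and reflecting remainders.

  *-∑≤-factor : ∀ ψ L y {g h : ℕ → K} → (∀ m .⦃ _ : NonZero m ⦄ → fromℕ m ≤ y → g m ≡ L * h m) → ψ * ∑≤ y g ≡ ψ * L * ∑≤ y h
  *-∑≤-factor ψ L y {g} {h} g≡Lh = begin
    ψ * ∑≤ y g                  ≡⟨ cong (ψ *_) (∑≤-cong y g≡Lh) ⟩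
    ψ * ∑≤ y (λ m → L * h m)    ≡⟨ cong (ψ *_) (*-∑≤ L y h) ⟨
    ψ * (L * ∑≤ y h)            ≡⟨ *-assoc ψ L (∑≤ y h) ⟨
    ψ * L * ∑≤ y h              ∎

  -- On the line `n = ℓ m` the weight of `n` splits into a constant `L` and a weight `c m`, which
  -- merges with `p m`. In the application n^(-s) becomes ℓ^(-s) m^(-s), and m^(s-δ) m^(-s) leaves
  -- m^(-δ).
  ⟨⟩-diagonal : ∀ y ℓ ψ L (a b h p k c : ℕ → K) →
    (∀ m n .⦃ _ : NonZero m ⦄ .⦃ _ : NonZero n ⦄ → fromℕ m ≤ y → fromℕ n ≡ ℓ *ᴿ fromℕ m → h n ≡ L * c m) →
    (∀ m .⦃ _ : NonZero m ⦄ → p m * c m ≡ k m) →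
    ψ * ∑≤ y (λ m → b m * p m * (λ n → a n * h n) ⟨ ℓ *ᴿ fromℕ m ⟩) ≡ ψ * L * ∑≤ y (λ m → b m * a ⟨ ℓ *ᴿ fromℕ m ⟩ * k m)
  ⟨⟩-diagonal y ℓ ψ L a b h p k c h≡ pc≡k = *-∑≤-factor ψ L y λ m m≤y →
    let r = ℓ *ᴿ fromℕ m in begin
    b m * p m * (λ n → a n * h n) ⟨ r ⟩    ≡⟨ cong (b m * p m *_) (⟨⟩-* a h (λ n → h≡ m n m≤y)) ⟩
    b m * p m * (a ⟨ r ⟩ * (L * c m))      ≡⟨ rearrange (b m) (p m) (a ⟨ r ⟩) L (c m) ⟩
    L * (b m * a ⟨ r ⟩ * (p m * c m))      ≡⟨ cong (λ z → L * (b m * a ⟨ r ⟩ * z)) (pc≡k m) ⟩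
    L * (b m * a ⟨ r ⟩ * k m)              ∎
    where
    rearrange : ∀ b p a L c → b * p * (a * (L * c)) ≡ L * (b * a * (p * c))
    rearrange = solve 5 (λ b p a L c → b :* p :* (a :* (L :* c)) := L :* (b :* a :* (p :* c))) refl

  -- All terms of the convolution have `u v = n`, so by complete multiplicativity they carry the
  -- common factor `χ n`. It is used with `χ` a power of `n`.
  ⋆-* : ∀ (a b χ : ℕ → K) → (∀ u v .⦃ _ : NonZero u ⦄ .⦃ _ : NonZero v ⦄ → χ (u ℕ.* v) ≡ χ u * χ v) →
        ∀ n .⦃ _ : NonZero n ⦄ → ((λ u → a u * χ u) ⋆ (λ v → b v * χ v)) n ≡ (a ⋆ b) n * χ n
  ⋆-* a b χ χ-* n = begin
    ((λ u → a u * χ u) ⋆ (λ v → b v * χ v)) n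
      ≡⟨ ⋆≡∑∑ n (λ u → a u * χ u) (λ v → b v * χ v) ℕₚ.≤-refl ⟩
    (∑ n λ u → ∑ n λ v → 𝟙 (u ℕ.* v ℕₚ.≟ n) * ((a u * χ u) * (b v * χ v)))
      ≡⟨ ∑-cong n (λ u → ∑-cong n λ v → trans
           (𝟙-guard (u ℕ.* v ℕₚ.≟ n) λ uv≡n → trans (interchange (a u) (χ u) (b v) (χ v)) (cong (_* (a u * b v)) (trans (sym (χ-* u v)) (cong χ uv≡n))))
           (rearrange (𝟙 (u ℕ.* v ℕₚ.≟ n)) (χ n) (a u * b v))) ⟩
    (∑ n λ u → ∑ n λ v → χ n * (𝟙 (u ℕ.* v ℕₚ.≟ n) * (a u * b v)))
      ≡⟨ ∑-cong n (λ u → *-∑ (χ n) n _) ⟨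
    (∑ n λ u → χ n * ∑ n λ v → 𝟙 (u ℕ.* v ℕₚ.≟ n) * (a u * b v))
      ≡⟨ *-∑ (χ n) n _ ⟨
    χ n * ∑∑ n a b (λ u v → u ℕ.* v ℕₚ.≟ n)
      ≡⟨ cong (χ n *_) (⋆≡∑∑ n a b ℕₚ.≤-refl) ⟨
    χ n * (a ⋆ b) n
      ≡⟨ *-comm (χ n) ((a ⋆ b) n) ⟩
    (a ⋆ b) n * χ n
      ∎
    where
    interchange : ∀ a x b y → (a * x) * (b * y) ≡ (x * y) * (a * b)
    interchange = solve 4 (λ a x b y → (a :* x) :* (b :* y) := (x :* y) :* (a :* b)) refl
    rearrange : ∀ i x c → i * (x * c) ≡ x * (i * c)
    rearrange = solve 3 (λ i x c → i :* (x :* c) := x :* (i :* c)) refl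

  -- The second relation has the two sums of the first one interchanged. Multiplying it by `ψ`
  -- restores both main terms, since `ψ * ψ′` is one, and only the remainders are left to compare.
  remainder-reflection : ∀ {f f′ ψ ψ′ e e′ P Q} → f ≡ P + ψ * Q + e → f′ ≡ Q + ψ′ * P + e′ →
    f ≡ ψ * f′ → ψ * ψ′ ≡ 1# → e ≡ ψ * e′
  remainder-reflection {f} {f′} {ψ} {ψ′} {e} {e′} {P} {Q} f≡ f′≡ f≡ψf′ ψψ′≡1 = +-cancelʳ (P + ψ * Q) e (ψ * e′) (begin
    e + (P + ψ * Q)                  ≡⟨ +-comm e (P + ψ * Q) ⟩
    P + ψ * Q + e                    ≡⟨ f≡ ⟨
    f                                ≡⟨ f≡ψf′ ⟩
    ψ * f′                           ≡⟨ cong (ψ *_) f′≡ ⟩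
    ψ * (Q + ψ′ * P + e′)            ≡⟨ solve 5 (λ ψ ψ′ P Q e′ → ψ :* (Q :+ ψ′ :* P :+ e′) := ψ :* e′ :+ (ψ :* ψ′ :* P :+ ψ :* Q)) refl ψ ψ′ P Q e′ ⟩
    ψ * e′ + (ψ * ψ′ * P + ψ * Q)    ≡⟨ cong (λ z → ψ * e′ + (z * P + ψ * Q)) ψψ′≡1 ⟩
    ψ * e′ + (1# * P + ψ * Q)        ≡⟨ cong (λ z → ψ * e′ + (z + ψ * Q)) (*-identityˡ P) ⟩
    ψ * e′ + (P + ψ * Q)             ∎)

-- The complex numbers as a commutative ring with inverses.

module ComplexProperties (R : CompleteOrderedField) where
  open Complex R
  private
    module R = CompleteOrderedField R
    module ℝₚ = OrderedFieldProperties R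
  open ℝₚ using (solve; _:=_; _:+_; _:*_)

  private
    -ᴿ≡ : ∀ x → -ᴿ x ≡ -ᴿ 1# *ᴿ x
    -ᴿ≡ x = trans (cong -ᴿ_ (sym (ℝₚ.*-identityˡ x))) (ℝₚ.-‿distribˡ-* 1# x)

    -- The product of a + b i and c + d i where i² = j.  Associativity and
    -- distributivity hold for every j, hence are semiring identities.
    re-* im-* : (j a b c d : ℝ) → ℝ
    re-* j a b c d = a *ᴿ c +ᴿ j *ᴿ (b *ᴿ d)
    im-* j a b c d = a *ᴿ d +ᴿ b *ᴿ c

    *≡ : ∀ z w → z * w ≡ re-* (-ᴿ 1#) (re z) (im z) (re w) (im w) +i im-* (-ᴿ 1#) (re z) (im z) (re w) (im w)
    *≡ (a +i b) (c +i d) = cong (λ t → (a *ᴿ c +ᴿ t) +i (a *ᴿ d +ᴿ b *ᴿ c)) (-ᴿ≡ (b *ᴿ d))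

  *-assoc : ∀ z w v → (z * w) * v ≡ z * (w * v)
  *-assoc z@(a +i b) w@(c +i d) v@(e +i f) = begin
    (z * w) * v
      ≡⟨ cong (_* v) (*≡ z w) ⟩
    (re-* j a b c d +i im-* j a b c d) * v
      ≡⟨ *≡ (re-* j a b c d +i im-* j a b c d) v ⟩
    re-* j (re-* j a b c d) (im-* j a b c d) e f +i im-* j (re-* j a b c d) (im-* j a b c d) e f
      ≡⟨ cong₂ _+i_
           (solve 7 (λ j a b c d e f → (a :* c :+ j :* (b :* d)) :* e :+ j :* ((a :* d :+ b :* c) :* f)
                                    := a :* (c :* e :+ j :* (d :* f)) :+ j :* (b :* (c :* f :+ d :* e))) refl j a b c d e f)
           (solve 7 (λ j a b c d e f → (a :* c :+ j :* (b :* d)) :* f :+ (a :* d :+ b :* c) :* e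
                                    := a :* (c :* f :+ d :* e) :+ b :* (c :* e :+ j :* (d :* f))) refl j a b c d e f) ⟩
    re-* j a b (re-* j c d e f) (im-* j c d e f) +i im-* j a b (re-* j c d e f) (im-* j c d e f)
      ≡⟨ *≡ z (re-* j c d e f +i im-* j c d e f) ⟨
    z * (re-* j c d e f +i im-* j c d e f)
      ≡⟨ cong (z *_) (*≡ w v) ⟨
    z * (w * v) ∎
    where
    open ≡-Reasoning
    j = -ᴿ 1#

  *-comm : ∀ z w → z * w ≡ w * z
  *-comm (a +i b) (c +i d) = cong₂ _+i_
    (cong₂ (λ x y → x -ᴿ y) (ℝₚ.*-comm a c) (ℝₚ.*-comm b d))
    (trans (ℝₚ.+-comm _ _) (cong₂ _+ᴿ_ (ℝₚ.*-comm b c) (ℝₚ.*-comm a d)))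

  *-distribˡ-+ : ∀ z w v → z * (w + v) ≡ z * w + z * v
  *-distribˡ-+ z@(a +i b) w@(c +i d) v@(e +i f) = begin
    z * (w + v)
      ≡⟨ *≡ z (w + v) ⟩
    re-* j a b (c +ᴿ e) (d +ᴿ f) +i im-* j a b (c +ᴿ e) (d +ᴿ f)
      ≡⟨ cong₂ _+i_
           (solve 7 (λ j a b c d e f → a :* (c :+ e) :+ j :* (b :* (d :+ f))
                                    := (a :* c :+ j :* (b :* d)) :+ (a :* e :+ j :* (b :* f))) refl j a b c d e f)
           (solve 6 (λ a b c d e f → a :* (d :+ f) :+ b :* (c :+ e) := (a :* d :+ b :* c) :+ (a :* f :+ b :* e)) refl a b c d e f) ⟩
    (re-* j a b c d +i im-* j a b c d) + (re-* j a b e f +i im-* j a b e f)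
      ≡⟨ cong₂ _+_ (*≡ z w) (*≡ z v) ⟨
    z * w + z * v ∎
    where
    open ≡-Reasoning
    j = -ᴿ 1#

  *-identityˡ : ∀ z → 1ℂ * z ≡ z
  *-identityˡ (a +i b) = cong₂ _+i_
    (trans (cong₂ (λ x y → x -ᴿ y) (ℝₚ.*-identityˡ a) (ℝₚ.zeroˡ b)) (trans (cong (a +ᴿ_) ℝₚ.-0#≈0#) (ℝₚ.+-identityʳ a)))
    (trans (cong₂ _+ᴿ_ (ℝₚ.*-identityˡ b) (ℝₚ.zeroˡ a)) (ℝₚ.+-identityʳ b))

  isCommutativeRing : IsCommutativeRing _≡_ _+_ _*_ -_ 0ℂ 1ℂ
  isCommutativeRing = record
    { isRing = record
      { +-isAbelianGroup = record
        { isGroup = record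
          { isMonoid = record
            { isSemigroup = record
              { isMagma = record { isEquivalence = isEquivalence ; ∙-cong = cong₂ _+_ }
              ; assoc = λ z w v → cong₂ _+i_ (ℝₚ.+-assoc (re z) (re w) (re v)) (ℝₚ.+-assoc (im z) (im w) (im v))
              }
            ; identity = comm∧idˡ⇒id +-comm +-identityˡ
            }
          ; inverse = comm∧invˡ⇒inv +-comm λ z → cong₂ _+i_ (ℝₚ.-‿inverseˡ (re z)) (ℝₚ.-‿inverseˡ (im z))
          ; ⁻¹-cong = cong (λ z → - z)
          }
        ; comm = +-comm
        }
      ; *-cong = cong₂ _*_
      ; *-assoc = *-assoc
      ; *-identity = comm∧idˡ⇒id *-comm *-identityˡ
      ; distrib = comm∧distrˡ⇒distr (cong₂ _+_) *-comm *-distribˡ-+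
      }
    ; *-comm = *-comm
    }
    where
    +-comm : ∀ z w → z + w ≡ w + z
    +-comm z w = cong₂ _+i_ (ℝₚ.+-comm (re z) (re w)) (ℝₚ.+-comm (im z) (im w))
    +-identityˡ : ∀ z → 0ℂ + z ≡ z
    +-identityˡ z = cong₂ _+i_ (ℝₚ.+-identityˡ (re z)) (ℝₚ.+-identityˡ (im z))

  commutativeRing : CommutativeRing 0ℓ 0ℓ
  commutativeRing = record { isCommutativeRing = isCommutativeRing }

  ≢0⇒∣∣²≢0 : ∀ {z} → z ≢ 0ℂ → ∣ z ∣² ≢ 0#
  ≢0⇒∣∣²≢0 {a +i b} z≢0 n≡0 = z≢0 (cong₂ _+i_ (root a b n≡0) (root b a (trans (ℝₚ.+-comm _ _) n≡0)))
    where
    root : ∀ x y → x *ᴿ x +ᴿ y *ᴿ y ≡ 0# → x ≡ 0#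
    root x y n≡0 with x ≟ᴿ 0#
    ... | yes x≡0 = x≡0
    ... | no x≢0  = ⊥-elim (x≢0 (ℝₚ.*-cancelʳ x≢0 (trans (ℝₚ.≤-antisym x²≤0 (ℝₚ.0≤x² x)) (sym (ℝₚ.zeroˡ x)))))
      where
      x²≤0 : x *ᴿ x ≤ᴿ 0#
      x²≤0 = subst₂ _≤ᴿ_ (ℝₚ.+-identityʳ _) n≡0 (R.+-monoʳ-≤ (x *ᴿ x) (ℝₚ.0≤x² y))

  inverse : ∀ {z} → z ≢ 0ℂ → ∃[ w ] z * w ≡ 1ℂ
  -- The witness is the conjugate divided by the squared modulus.
  inverse {z@(a +i b)} z≢0 = (a *ᴿ n⁻¹) +i (-ᴿ (b *ᴿ n⁻¹)) , cong₂ _+i_ real imaginary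
    where
    open ≡-Reasoning
    n⁻¹ = ∣ z ∣² R.⁻¹
    real : a *ᴿ (a *ᴿ n⁻¹) -ᴿ b *ᴿ (-ᴿ (b *ᴿ n⁻¹)) ≡ 1#
    real = begin
      a *ᴿ (a *ᴿ n⁻¹) -ᴿ b *ᴿ (-ᴿ (b *ᴿ n⁻¹))    ≡⟨ cong (λ t → a *ᴿ (a *ᴿ n⁻¹) -ᴿ t) (ℝₚ.-‿distribʳ-* b (b *ᴿ n⁻¹)) ⟨
      a *ᴿ (a *ᴿ n⁻¹) -ᴿ (-ᴿ (b *ᴿ (b *ᴿ n⁻¹)))  ≡⟨ cong (a *ᴿ (a *ᴿ n⁻¹) +ᴿ_) (ℝₚ.-‿involutive (b *ᴿ (b *ᴿ n⁻¹))) ⟩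
      a *ᴿ (a *ᴿ n⁻¹) +ᴿ b *ᴿ (b *ᴿ n⁻¹)         ≡⟨ solve 3 (λ a b n → a :* (a :* n) :+ b :* (b :* n) := (a :* a :+ b :* b) :* n) refl a b n⁻¹ ⟩
      ∣ z ∣² *ᴿ n⁻¹                              ≡⟨ R.⁻¹-inverseʳ ∣ z ∣² (≢0⇒∣∣²≢0 z≢0) ⟩
      1#                                         ∎
    imaginary : a *ᴿ (-ᴿ (b *ᴿ n⁻¹)) +ᴿ b *ᴿ (a *ᴿ n⁻¹) ≡ 0#
    imaginary = begin
      a *ᴿ (-ᴿ (b *ᴿ n⁻¹)) +ᴿ b *ᴿ (a *ᴿ n⁻¹)    ≡⟨ cong₂ _+ᴿ_ (sym (ℝₚ.-‿distribʳ-* a (b *ᴿ n⁻¹))) (solve 3 (λ a b n → b :* (a :* n) := a :* (b :* n)) refl a b n⁻¹) ⟩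
      -ᴿ (a *ᴿ (b *ᴿ n⁻¹)) +ᴿ a *ᴿ (b *ᴿ n⁻¹)    ≡⟨ ℝₚ.-‿inverseˡ (a *ᴿ (b *ᴿ n⁻¹)) ⟩
      0#                                         ∎

  _≟_ : DecidableEquality ℂ
  (a +i b) ≟ (c +i d) with a ≟ᴿ c | b ≟ᴿ d
  ... | yes refl | yes refl = yes refl
  ... | no a≢c   | _        = no λ { refl → a≢c refl }
  ... | yes _    | no b≢d   = no λ { refl → b≢d refl }

  *-fixed⇒≡1 : ∀ {k z} → z ≢ 0ℂ → z ≡ k * z → k ≡ 1ℂ
  *-fixed⇒≡1 {k} {z} z≢0 z≡kz = let w , zw≡1 = inverse z≢0 in begin
    k              ≡⟨ trans (*-comm k 1ℂ) (*-identityˡ k) ⟨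
    k * 1ℂ         ≡⟨ cong (k *_) zw≡1 ⟨
    k * (z * w)    ≡⟨ *-assoc k z w ⟨
    (k * z) * w    ≡⟨ cong (_* w) z≡kz ⟨
    z * w          ≡⟨ zw≡1 ⟩
    1ℂ             ∎
    where open ≡-Reasoning

-- Complex powers of positive reals.

module DirichletProperties (R : CompleteOrderedField) (X : Complex.Exponential R) where
  open Dirichlet R X
  private
    module ℝₚ = OrderedFieldProperties R
    module ℂₚ where
      open ComplexProperties R public
      open CommutativeRing commutativeRing public
        using (+-assoc; +-comm; +-identityʳ; -‿inverseˡ; -‿inverseʳ; distribˡ; distribʳ; ring)
      open RingProperties ring public using (-‿involutive; -‿+-comm)
    module S = Summation R ℂₚ.isCommutativeRing

  -- By `log-exp` a real whose exponential is `x *ᴿ y` must be its logarithm, so it is enough to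
  -- exponentiate the sum of the logarithms.
  log-* : ∀ {x y} → 0# <ᴿ x → 0# <ᴿ y → log (x *ᴿ y) ≡ log x +ᴿ log y
  log-* {x} {y} 0<x 0<y = log-exp (x *ᴿ y) (log x +ᴿ log y) (begin
    exp (ofℝ (log x +ᴿ log y))               ≡⟨ cong (λ t → exp ((log x +ᴿ log y) +i t)) (ℝₚ.+-identityˡ 0#) ⟨
    exp (ofℝ (log x) + ofℝ (log y))          ≡⟨ exp-+ (ofℝ (log x)) (ofℝ (log y)) ⟩
    exp (ofℝ (log x)) * exp (ofℝ (log y))    ≡⟨ cong₂ _*_ (exp-log x 0<x) (exp-log y 0<y) ⟩
    ofℝ x * ofℝ y                            ≡⟨ cong₂ _+i_
        (trans (cong (λ t → x *ᴿ y -ᴿ t) (ℝₚ.zeroˡ 0#)) (trans (cong (x *ᴿ y +ᴿ_) ℝₚ.-0#≈0#) (ℝₚ.+-identityʳ (x *ᴿ y))))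
        (trans (cong₂ _+ᴿ_ (ℝₚ.zeroʳ x) (ℝₚ.zeroˡ y)) (ℝₚ.+-identityʳ 0#)) ⟩
    ofℝ (x *ᴿ y)                             ∎)
    where open ≡-Reasoning

  ^-distribʳ-* : ∀ s {x y} → 0# <ᴿ x → 0# <ᴿ y → (x *ᴿ y) ^ s ≡ x ^ s * y ^ s
  ^-distribʳ-* s {x} {y} 0<x 0<y = begin
    exp (s * ofℝ (log (x *ᴿ y)))                    ≡⟨ cong (λ t → exp (s * ofℝ t)) (log-* 0<x 0<y) ⟩
    exp (s * ofℝ (log x +ᴿ log y))                  ≡⟨ cong (λ t → exp (s * ((log x +ᴿ log y) +i t))) (ℝₚ.+-identityˡ 0#) ⟨
    exp (s * (ofℝ (log x) + ofℝ (log y)))           ≡⟨ cong exp (ℂₚ.distribˡ s (ofℝ (log x)) (ofℝ (log y))) ⟩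
    exp (s * ofℝ (log x) + s * ofℝ (log y))         ≡⟨ exp-+ (s * ofℝ (log x)) (s * ofℝ (log y)) ⟩
    exp (s * ofℝ (log x)) * exp (s * ofℝ (log y))   ∎
    where open ≡-Reasoning

  ^-+ : ∀ x s t → x ^ s * x ^ t ≡ x ^ (s + t)
  ^-+ x s t = trans (sym (exp-+ (s * ofℝ (log x)) (t * ofℝ (log x)))) (cong exp (sym (ℂₚ.distribʳ (ofℝ (log x)) s t)))

  fromℕ-^-* : ∀ s u v .⦃ _ : NonZero u ⦄ .⦃ _ : NonZero v ⦄ → fromℕ (u ℕ.* v) ^ s ≡ fromℕ u ^ s * fromℕ v ^ s
  fromℕ-^-* s u v = trans (cong (_^ s) (ℝₚ.fromℕ-* u v)) (^-distribʳ-* s (ℝₚ.fromℕ-positive u) (ℝₚ.fromℕ-positive v))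

  [s-δ]-s≡-δ : ∀ s δ → (s - δ) + (- s) ≡ - δ
  [s-δ]-s≡-δ s δ = begin
    (s - δ) + (- s)      ≡⟨ cong (_+ (- s)) (ℂₚ.+-comm s (- δ)) ⟩
    (- δ + s) + (- s)    ≡⟨ ℂₚ.+-assoc (- δ) s (- s) ⟩
    - δ + (s + (- s))    ≡⟨ cong (- δ +_) (ℂₚ.-‿inverseʳ s) ⟩
    - δ + 0ℂ             ≡⟨ ℂₚ.+-identityʳ (- δ) ⟩
    - δ                  ∎
    where open ≡-Reasoning

  -[δ-s]≡s-δ : ∀ s δ → - (δ - s) ≡ s - δ
  -[δ-s]≡s-δ s δ = begin
    - (δ - s)          ≡⟨ ℂₚ.-‿+-comm δ (- s) ⟨
    - δ + (- (- s))    ≡⟨ cong (- δ +_) (ℂₚ.-‿involutive s) ⟩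
    - δ + s            ≡⟨ ℂₚ.+-comm (- δ) s ⟩
    s - δ              ∎
    where open ≡-Reasoning

  [δ-s]-δ≡-s : ∀ s δ → (δ - s) - δ ≡ - s
  [δ-s]-δ≡-s s δ = [s-δ]-s≡-δ δ s

  δ-[δ-s]≡s : ∀ s δ → δ - (δ - s) ≡ s
  δ-[δ-s]≡s s δ = begin
    δ - (δ - s)        ≡⟨ cong (δ +_) (-[δ-s]≡s-δ s δ) ⟩
    δ + (s - δ)        ≡⟨ ℂₚ.+-comm δ (s - δ) ⟩
    (s - δ) + δ        ≡⟨ ℂₚ.+-assoc s (- δ) δ ⟩
    s + (- δ + δ)      ≡⟨ cong (s +_) (ℂₚ.-‿inverseˡ δ) ⟩
    s + 0ℂ             ≡⟨ ℂₚ.+-identityʳ s ⟩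
    s                  ∎
    where open ≡-Reasoning

  ∑≤-⋆-^ : ∀ z s (a b : ℕ → ℂ) →
    ∑≤ z ((λ n → a n * fromℕ n ^ s) ⋆ (λ n → b n * fromℕ n ^ s)) ≡ ∑≤ z (λ n → (a ⋆ b) n * fromℕ n ^ s)
  ∑≤-⋆-^ z s a b = S.∑≤-cong z λ n _ → S.⋆-* a b (λ n → fromℕ n ^ s) (λ u v → fromℕ-^-* s u v) n

  diagonal-sum : ∀ {x y} → 0# <ᴿ x → ∀ s δ ψ (a b : ℕ → ℂ) → let ℓ = x /ᴿ y in
    ψ * ∑≤ y (λ m → b m * fromℕ m ^ (s - δ) * (λ n → a n * fromℕ n ^ (- s)) ⟨ ℓ *ᴿ fromℕ m ⟩)
      ≡ ψ * ℓ ^ (- s) * ∑≤ y (λ m → b m * a ⟨ ℓ *ᴿ fromℕ m ⟩ * fromℕ m ^ (- δ))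
  diagonal-sum {x} {y} 0<x s δ ψ a b =
    S.⟨⟩-diagonal y (x /ᴿ y) ψ ((x /ᴿ y) ^ (- s)) a b (λ n → fromℕ n ^ (- s)) (λ m → fromℕ m ^ (s - δ)) (λ m → fromℕ m ^ (- δ)) (λ m → fromℕ m ^ (- s))
      (λ m n m≤y n≡ℓm → trans (cong (_^ (- s)) n≡ℓm)
        (^-distribʳ-* (- s) (ℝₚ./-positive 0<x (ℝₚ.<-≤-trans (ℝₚ.fromℕ-positive m) m≤y)) (ℝₚ.fromℕ-positive m)))
      (λ m → trans (^-+ (fromℕ m) (s - δ) (- s)) (cong (fromℕ m ^_) ([s-δ]-s≡-δ s δ)))

  -- The product of two relations of Dirichlet series.

  module _ {δ : ℂ} {Ω : Pred ℂ 0ℓ} where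

    product-of-relations : ∀ (F₁ F₂ : Relation δ Ω) s → Ω s → ∀ x₁ x₂ → 0# <ᴿ x₁ → 0# <ᴿ x₂ →
      let open Product F₁ F₂ s x₁ x₂ in
      f₁ s * f₂ s ≡ ∑≤ (x₁ *ᴿ x₂) (λ n → A n * fromℕ n ^ (- s))
                    + ψ₁ s * ψ₂ s * ∑≤ (y₁ *ᴿ y₂) (λ n → B n * fromℕ n ^ (s - δ))
                    + E₁₂
    product-of-relations F₁ F₂ s s∈Ω x₁ x₂ 0<x₁ 0<x₂ = begin
      f₁ s * f₂ s
        ≡⟨ S.product-relation α₁ α₂ β₁ β₂ (E₁ s) (E₂ s)
             (Relation.T-nonNeg F₁ s s∈Ω) (Relation.T-nonNeg F₂ s s∈Ω)
             (Relation.relation F₁ s s∈Ω) (Relation.relation F₂ s s∈Ω) 0<x₁ 0<x₂ ⟩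
      ∑≤ (x₁ *ᴿ x₂) (α₁ ⋆ α₂) + ψ₁ s * ψ₂ s * ∑≤ (y₁ *ᴿ y₂) (β₁ ⋆ β₂) + (I₁ + I₂ + I₃ + I₄ + I₅ + M₁ + M₂)
        ≡⟨ cong₂ _+_ (cong₂ _+_ (∑≤-⋆-^ (x₁ *ᴿ x₂) (- s) a₁ a₂) (cong (ψ₁ s * ψ₂ s *_) (∑≤-⋆-^ (y₁ *ᴿ y₂) (s - δ) b₁ b₂)))
                     (cong₂ _+_ (cong (I₁ + I₂ + I₃ + I₄ + I₅ +_) (diagonal-sum 0<x₂ s δ (ψ₁ s) a₂ b₁)) (diagonal-sum 0<x₁ s δ (ψ₂ s) a₁ b₂)) ⟩
      ∑≤ (x₁ *ᴿ x₂) (λ n → A n * fromℕ n ^ (- s)) + ψ₁ s * ψ₂ s * ∑≤ (y₁ *ᴿ y₂) (λ n → B n * fromℕ n ^ (s - δ)) + E₁₂ ∎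
      where
      open ≡-Reasoning
      open Product F₁ F₂ s x₁ x₂
      α₁ α₂ β₁ β₂ : ℕ → ℂ
      α₁ n = a₁ n * fromℕ n ^ (- s)
      α₂ n = a₂ n * fromℕ n ^ (- s)
      β₁ n = b₁ n * fromℕ n ^ (s - δ)
      β₂ n = b₂ n * fromℕ n ^ (s - δ)
      M₁ M₂ : ℂ
      M₁ = ψ₁ s * ∑≤ y₁ (λ m → β₁ m * α₂ ⟨ ℓ₂ *ᴿ fromℕ m ⟩)
      M₂ = ψ₂ s * ∑≤ y₂ (λ m → β₂ m * α₁ ⟨ ℓ₁ *ᴿ fromℕ m ⟩)

    -- Remainders under a functional equation.

    module _ (F : Relation δ Ω) (functionalEquation : FunctionalEquation F) (selfDual : SelfDual F)
             {s : ℂ} (s∈Ω : Ω s) (s′∈Ω : Ω (δ - s)) where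
      open Relation F
      open SelfDual selfDual

      ψψ′≡1 : ψ s * ψ (δ - s) ≡ 1ℂ
      ψψ′≡1 with f s ℂₚ.≟ 0ℂ
      ... | yes fs≡0 = ψ-zeros s s∈Ω s′∈Ω fs≡0
      ... | no fs≢0  = ℂₚ.*-fixed⇒≡1 fs≢0 (begin
        f s                                     ≡⟨ functionalEquation s s∈Ω s′∈Ω ⟩
        ψ s * f (δ - s)                         ≡⟨ cong (ψ s *_) (functionalEquation (δ - s) s′∈Ω (subst Ω (sym (δ-[δ-s]≡s s δ)) s∈Ω)) ⟩
        ψ s * (ψ (δ - s) * f (δ - (δ - s)))     ≡⟨ cong (λ t → ψ s * (ψ (δ - s) * f t)) (δ-[δ-s]≡s s δ) ⟩
        ψ s * (ψ (δ - s) * f s)                 ≡⟨ ℂₚ.*-assoc (ψ s) (ψ (δ - s)) (f s) ⟨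
        (ψ s * ψ (δ - s)) * f s                 ∎)
        where open ≡-Reasoning

      -- The two quotient hypotheses express that `x` and `x′` are dual lengths of each other. The
      -- relation at `δ - s` and `x′` then has the same two sums in exchanged roles: the exponents
      -- are exchanged by the reflection, the lengths by duality, and the coefficients agree by
      -- `b≡a`.
      E-reflection : ∀ {x x′} → 0# <ᴿ x → 0# <ᴿ x′ → T s /ᴿ x ≡ x′ → T s /ᴿ x′ ≡ x → E s x ≡ ψ s * E (δ - s) x′
      E-reflection {x} {x′} 0<x 0<x′ T/x≡x′ T/x′≡x =
        S.remainder-reflection
          (trans (relation s s∈Ω x 0<x) (cong (λ y → P + ψ s * ∑≤ y (λ n → b n * fromℕ n ^ (s - δ)) + E s x) T/x≡x′))
          (trans (relation (δ - s) s′∈Ω x′ 0<x′) (cong₂ (λ q p → q + ψ (δ - s) * p + E (δ - s) x′) dual-Q dual-P))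
          (functionalEquation s s∈Ω s′∈Ω)
          ψψ′≡1
        where
        P Q : ℂ
        P = ∑≤ x (λ n → a n * fromℕ n ^ (- s))
        Q = ∑≤ x′ (λ n → b n * fromℕ n ^ (s - δ))
        b≡a′ : ∀ n .⦃ _ : NonZero n ⦄ → b n ≡ a n
        b≡a′ (suc n) = b≡a n
        dual-Q : ∑≤ x′ (λ n → a n * fromℕ n ^ (- (δ - s))) ≡ Q
        dual-Q = S.∑≤-cong x′ λ n _ → cong₂ (λ c t → c * fromℕ n ^ t) (sym (b≡a′ n)) (-[δ-s]≡s-δ s δ)
        dual-P : ∑≤ (T (δ - s) /ᴿ x′) (λ n → b n * fromℕ n ^ ((δ - s) - δ)) ≡ P
        dual-P = trans (cong (λ y → ∑≤ y (λ n → b n * fromℕ n ^ ((δ - s) - δ))) (trans (cong (_/ᴿ x′) (T-sym s s∈Ω s′∈Ω)) T/x′≡x))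
                       (S.∑≤-cong x λ n _ → cong₂ (λ c t → c * fromℕ n ^ t) (b≡a′ n) ([δ-s]-δ≡-s s δ))

      -- The point `m x / y` has the mirror `y z / m`. The relation can be used there only if this
      -- is positive, which matters only when the sum has a term, that is, when `y` is at least one.
      -- Here `y` belongs to the other relation, while `x` and `z` belong to `F`.
      reflected-sum : ∀ {x y} → 0# <ᴿ x → let z = T s /ᴿ x in (1# ≤ᴿ y → 0# <ᴿ y *ᴿ z) → ∀ c (g : ℕ → ℂ) →
        c * ∑≤ y (λ m → g m * E s (fromℕ m *ᴿ x /ᴿ y)) ≡ c * ψ s * ∑≤ y (λ m → g m * E (δ - s) (y *ᴿ z /ᴿ fromℕ m))
      reflected-sum {x} {y} 0<x 0<yz c g = S.*-∑≤-factor c (ψ s) y λ m m≤y → begin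
        g m * E s (fromℕ m *ᴿ x /ᴿ y)                  ≡⟨ cong (g m *_) (reflect m m≤y) ⟩
        g m * (ψ s * E (δ - s) (y *ᴿ z /ᴿ fromℕ m))    ≡⟨ ℂₚ.*-assoc (g m) (ψ s) _ ⟨
        (g m * ψ s) * E (δ - s) (y *ᴿ z /ᴿ fromℕ m)    ≡⟨ cong (_* E (δ - s) (y *ᴿ z /ᴿ fromℕ m)) (ℂₚ.*-comm (g m) (ψ s)) ⟩
        (ψ s * g m) * E (δ - s) (y *ᴿ z /ᴿ fromℕ m)    ≡⟨ ℂₚ.*-assoc (ψ s) (g m) _ ⟩
        ψ s * (g m * E (δ - s) (y *ᴿ z /ᴿ fromℕ m))    ∎
        where
        open ≡-Reasoning
        z = T s /ᴿ x

        reflect : ∀ m .⦃ _ : NonZero m ⦄ → fromℕ m ≤ᴿ y → E s (fromℕ m *ᴿ x /ᴿ y) ≡ ψ s * E (δ - s) (y *ᴿ z /ᴿ fromℕ m)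
        reflect m m≤y = E-reflection (ℝₚ./-positive (ℝₚ.*-positive 0<m 0<x) 0<y) (ℝₚ./-positive 0<y*z 0<m)
          (trans (ℝₚ.dual-length (T s) 0<m 0<x 0<y) (cong (_/ᴿ fromℕ m) (ℝₚ.*-comm z y)))
          (trans (ℝₚ.dual-length (T s) 0<y 0<z 0<m) (trans (cong (λ t → t *ᴿ fromℕ m /ᴿ y) T/z≡x) (cong (_/ᴿ y) (ℝₚ.*-comm x (fromℕ m)))))
          where
          0<m : 0# <ᴿ fromℕ m
          0<m = ℝₚ.fromℕ-positive m
          0<y : 0# <ᴿ y
          0<y = ℝₚ.<-≤-trans 0<m m≤y
          0<y*z : 0# <ᴿ y *ᴿ z
          0<y*z = 0<yz (ℝₚ.≤-trans (ℝₚ.1≤fromℕ m) m≤y)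
          -- Positivity of `z` excludes `T s = 0`; only then does dividing `T s` by `z` return `x`,
          -- so that reflecting twice gives back the original point.
          0<z : 0# <ᴿ z
          0<z = ℝₚ.x*0<c⇒x>0 0<y (subst (0# <ᴿ_) (ℝₚ.*-comm y z) 0<y*z)
          T/z≡x : T s /ᴿ z ≡ x
          T/z≡x = trans (cong (_/ᴿ z) (trans (sym (ℝₚ./-*-cancel (T s) 0<x)) (ℝₚ.*-comm z x))) (ℝₚ.*-/-cancel x (ℝₚ.<⇒≢0 0<z))

theorem1 : (R : CompleteOrderedField) (X : Complex.Exponential R) →
    let open Dirichlet R X in
    (δ : ℂ) (Ω : Pred ℂ 0ℓ) (F₁ F₂ : Relation δ Ω) →
    (∀ s → Ω s → ∀ x₁ x₂ → 0# <ᴿ x₁ → 0# <ᴿ x₂ →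
      let open Product F₁ F₂ s x₁ x₂ in
      f₁ s * f₂ s ≡ ∑≤ (x₁ *ᴿ x₂) (λ n → A n * fromℕ n ^ (- s))
                    + ψ₁ s * ψ₂ s * ∑≤ (y₁ *ᴿ y₂) (λ n → B n * fromℕ n ^ (s - δ))
                    + E₁₂)
    ×
    (FunctionalEquation F₁ → FunctionalEquation F₂ →
     SelfDual F₁ → SelfDual F₂ →
     ∀ s → Ω s → Ω (δ - s) → ∀ x₁ x₂ → 0# <ᴿ x₁ → 0# <ᴿ x₂ →
      let open Product F₁ F₂ s x₁ x₂ in
      -- E₁ and E₂ have a meaning only at positive reals, hence the condition
      -- on y₁ *ᴿ y₂ whenever the sum on the right is not empty.
      ((1# ≤ᴿ y₁ → 0# <ᴿ y₁ *ᴿ y₂) →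
        I₃ ≡ ψ₁ s * ψ₂ s * ∑≤ y₁ (λ n → b₁ n * fromℕ n ^ (s - δ) * E₂ (δ - s) (y₁ *ᴿ y₂ /ᴿ fromℕ n)))
      ×
      ((1# ≤ᴿ y₂ → 0# <ᴿ y₁ *ᴿ y₂) →
        I₄ ≡ ψ₁ s * ψ₂ s * ∑≤ y₂ (λ n → b₂ n * fromℕ n ^ (s - δ) * E₁ (δ - s) (y₁ *ᴿ y₂ /ᴿ fromℕ n))))
theorem1 R X δ Ω F₁ F₂ = product-of-relations F₁ F₂ , λ fe₁ fe₂ sd₁ sd₂ s s∈Ω s′∈Ω x₁ x₂ 0<x₁ 0<x₂ →
  let open Product F₁ F₂ s x₁ x₂ in
  (λ 0<y₁y₂ → reflected-sum F₂ fe₂ sd₂ s∈Ω s′∈Ω 0<x₂ 0<y₁y₂ (ψ₁ s) (λ m → b₁ m * fromℕ m ^ (s - δ))) ,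
  (λ 0<y₁y₂ → subst₂ (λ c t → I₄ ≡ c * ∑≤ y₂ (λ n → b₂ n * fromℕ n ^ (s - δ) * E₁ (δ - s) (t /ᴿ fromℕ n)))
    (ℂₚ.*-comm (ψ₂ s) (ψ₁ s)) (ℝₚ.*-comm y₂ y₁)
    (reflected-sum F₁ fe₁ sd₁ s∈Ω s′∈Ω 0<x₁ (λ 1≤y₂ → subst (0# <ᴿ_) (ℝₚ.*-comm y₁ y₂) (0<y₁y₂ 1≤y₂)) (ψ₂ s) (λ m → b₂ m * fromℕ m ^ (s - δ))))
  where
  open Dirichlet R X
  open DirichletProperties R X
  module ℝₚ = OrderedFieldProperties R
  module ℂₚ = ComplexProperties R
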